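{- There exists a magic-faced hypercube of dimension $n$ for every integer $n\ge 0$. Moreover: (a) If $n$ is even, then the magic-faced hypercube of dimension $n$ is unique up to the action of a permutation group $G_n$ of the $2^n$ positions (so $G_n\subset S_{2^n}$) with $G_n\cong C_2^n\rtimes S_{n+1}$; that is, the magic-faced hypercubes of dimension $n$ form a single orbit of $G_n$. (b) If $n$ is odd, then any magic-faced hypercube of dimension $n$ has a distinguished coordinate direction $j\in\{1,\ldots,n\}$ such that every pair of numbers on a line in direction $j$ sums to $2^n+1$. For each $j\in\{1,\ldots,n\}$, the magic-faced hypercube of dimension $n$ and distinguished direction $j$ is unique up to the action of a permutation group $G_{n,j}$ of the $2^n$ positions (so $G_{n,j}\subset S_{2^n}$) with $G_{n,j}\cong (C_2^{n-1}\rtimes S_n)\times C_2$; that is, the magic-faced hypercubes of dimension $n$ and direction $j$ form a single orbit of $G_{n,j}$. Hence there are exactly $2^n(n+1)!$ magic-faced hypercubes of dimension $n$ when $n$ is even, and exactly $n\cdot 2^n\, n!$ when $n$ is odd.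
   Context: The positions of a $2\times 2\times\cdots\times 2$ ($n$-fold) grid are the elements of $\{0,1\}^n$. A magic-faced hypercube of dimension $n$ is a bijection $A:\{0,1\}^n\to\{1,\ldots,2^n\}$ such that every $2\times 2$ face (the four positions obtained by fixing $n-2$ coordinates and letting the other two vary) has the same sum of labels. (For $n\le 1$ there are no such faces and the condition is vacuous.) A line in direction $j$ is a pair of positions differing exactly in coordinate $j$. A permutation $g$ of the positions acts on labelings by permuting positions, $A\mapsto A\circ g^{ -1}$. $C_2$ is the cyclic group of order $2$. In $C_2^{k}\rtimes S_{k+1}$, the group $C_2^k$ is identified with $\mathbb{F}_2^{k+1}/\langle e_0+\cdots+e_k\rangle$, where $e_0,\ldots,e_k$ is the standard basis, and $S_{k+1}$ acts by permuting $e_0,\ldots,e_k$ (here $k=n$ in (a) and $k=n-1$ in (b)). -}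

module Defs where

open import Algebra.Bundles using (Group; CommutativeRing)
open import Algebra.Morphism.Structures using (module GroupMorphisms)
open import Data.Bool.Base using (Bool; true; false; _xor_)
open import Data.Bool.Properties using (xor-∧-commutativeRing)
open import Data.Fin.Base using (Fin; toℕ)
open import Data.Nat.Base using (ℕ; suc; _+_; _^_)
open import Data.Product.Base using (Σ; ∃; ∃-syntax; _×_; _,_; proj₁; proj₂)
open import Data.Vec.Base using (Vec; lookup; _[_]≔_)
open import Function.Bundles using (_↔_; _⇔_; Inverse)
open import Function.Construct.Composition using (_↔-∘_)
open import Function.Construct.Identity using (↔-id)
open import Function.Construct.Symmetry using (↔-sym)
open import Level using (0ℓ)
open import Relation.Binary.Bundles using (Setoid)
open import Relation.Binary.PropositionalEquality
  using (_≡_; _≢_; refl; sym; trans; cong; cong₂; setoid)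
open import Relation.Unary using (Pred)

------------------------------------------------------------------------
-- Groups

Sym : Set → Group 0ℓ 0ℓ
Sym X = record
  { Carrier = X ↔ X
  ; _≈_     = λ f g → ∀ x → Inverse.to f x ≡ Inverse.to g x
  ; _∙_     = _↔-∘_
  ; ε       = ↔-id X
  ; _⁻¹     = ↔-sym
  ; isGroup = record
    { isMonoid = record
      { isSemigroup = record
        { isMagma = record
          { isEquivalence = record
            { refl  = λ x → refl
            ; sym   = λ p x → sym (p x)
            ; trans = λ p q x → trans (p x) (q x)
            }
          ; ∙-cong = λ {f} {f′} {g} {g′} p q x →
              trans (p (Inverse.to g x)) (cong (Inverse.to f′) (q x))
          }
        ; assoc = λ f g h x → refl
        }
      ; identity = (λ f x → refl) , (λ f x → refl)
      }
    ; inverse = (λ f x → Inverse.strictlyInverseʳ f x)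
              , (λ f x → Inverse.strictlyInverseˡ f x)
    ; ⁻¹-cong = λ {f} {g} → from-cong f g
    }
  }
  where
  from-cong : (f g : X ↔ X) → (∀ x → Inverse.to f x ≡ Inverse.to g x) →
              ∀ x → Inverse.from f x ≡ Inverse.from g x
  from-cong f g p x =
    trans (sym (Inverse.strictlyInverseʳ g (Inverse.from f x)))
          (cong (Inverse.from g)
                (trans (sym (p (Inverse.from f x)))
                       (Inverse.strictlyInverseˡ f x)))

record Subgroup (G : Group 0ℓ 0ℓ) : Set₁ where
  open Group G
  field
    Member   : Pred Carrier 0ℓ
    resp     : ∀ {x y} → x ≈ y → Member x → Member y
    ∙-closed : ∀ {x y} → Member x → Member y → Member (x ∙ y)
    ε-closed : Member ε
    ⁻¹-closed : ∀ {x} → Member x → Member (x ⁻¹)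

  group : Group 0ℓ 0ℓ
  group = record
    { Carrier = Σ Carrier Member
    ; _≈_     = λ x y → proj₁ x ≈ proj₁ y
    ; _∙_     = λ (x , p) (y , q) → x ∙ y , ∙-closed p q
    ; ε       = ε , ε-closed
    ; _⁻¹     = λ (x , p) → x ⁻¹ , ⁻¹-closed p
    ; isGroup = record
      { isMonoid = record
        { isSemigroup = record
          { isMagma = record
            { isEquivalence = record
              { refl  = Group.refl G
              ; sym   = Group.sym G
              ; trans = Group.trans G
              }
            ; ∙-cong = ∙-cong
            }
          ; assoc = λ (x , _) (y , _) (z , _) → assoc x y z
          }
        ; identity = (λ (x , _) → identityˡ x) , (λ (x , _) → identityʳ x)
        }
      ; inverse = (λ (x , _) → inverseˡ x) , (λ (x , _) → inverseʳ x)
      ; ⁻¹-cong = ⁻¹-cong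
      }
    }

infix 4 _≅_

_≅_ : Group 0ℓ 0ℓ → Group 0ℓ 0ℓ → Set
G ≅ H = ∃[ f ] IsGroupIsomorphism f
  where open GroupMorphisms (Group.rawGroup G) (Group.rawGroup H)

record ActionByAutomorphisms (H N : Group 0ℓ 0ℓ) : Set where
  private
    module H = Group H
    module N = Group N
  infixr 8 _▷_
  field
    _▷_        : H.Carrier → N.Carrier → N.Carrier
    ▷-cong     : ∀ {g h x y} → g H.≈ h → x N.≈ y → g ▷ x N.≈ h ▷ y
    ▷-homo     : ∀ g x y → g ▷ (x N.∙ y) N.≈ (g ▷ x) N.∙ (g ▷ y)
    ▷-assoc    : ∀ g h x → (g H.∙ h) ▷ x N.≈ g ▷ h ▷ x
    ▷-identity : ∀ x → H.ε ▷ x N.≈ x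

semidirectProduct : (N H : Group 0ℓ 0ℓ) → ActionByAutomorphisms H N →
                    Group 0ℓ 0ℓ
semidirectProduct N H act = record
  { Carrier = N.Carrier × H.Carrier
  ; _≈_     = λ (x , g) (y , h) → (x N.≈ y) × (g H.≈ h)
  ; _∙_     = λ (x , g) (y , h) → x N.∙ (g ▷ y) , g H.∙ h
  ; ε       = N.ε , H.ε
  ; _⁻¹     = λ (x , g) → (g H.⁻¹) ▷ (x N.⁻¹) , g H.⁻¹
  ; isGroup = record
    { isMonoid = record
      { isSemigroup = record
        { isMagma = record
          { isEquivalence = record
            { refl  = N.refl , H.refl
            ; sym   = λ (p , q) → N.sym p , H.sym q
            ; trans = λ (p , q) (p′ , q′) → N.trans p p′ , H.trans q q′
            }
          ; ∙-cong = λ (p , q) (p′ , q′) →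
              N.∙-cong p (▷-cong q p′) , H.∙-cong q q′
          }
        ; assoc = λ (x , g) (y , h) (z , k) →
            N.trans (N.assoc x (g ▷ y) ((g H.∙ h) ▷ z))
              (N.∙-congˡ (N.trans (N.∙-congˡ (▷-assoc g h z))
                                  (N.sym (▷-homo g y (h ▷ z)))))
            , H.assoc g h k
        }
      ; identity =
          (λ (x , g) → N.trans (N.identityˡ _) (▷-identity x) , H.identityˡ g)
        , (λ (x , g) → N.trans (N.∙-congˡ (▷-ε g)) (N.identityʳ x) , H.identityʳ g)
      }
    ; inverse =
        (λ (x , g) →
            N.trans (N.sym (▷-homo (g H.⁻¹) (x N.⁻¹) x))
              (N.trans (▷-cong H.refl (N.inverseˡ x)) (▷-ε (g H.⁻¹)))
          , H.inverseˡ g)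
      , (λ (x , g) →
            N.trans (N.∙-congˡ
              (N.trans (N.sym (▷-assoc g (g H.⁻¹) (x N.⁻¹)))
                (N.trans (▷-cong (H.inverseʳ g) N.refl) (▷-identity (x N.⁻¹)))))
              (N.inverseʳ x)
          , H.inverseʳ g)
    ; ⁻¹-cong = λ (p , q) →
        ▷-cong (H.⁻¹-cong q) (N.⁻¹-cong p) , H.⁻¹-cong q
    }
  }
  where
  module N = Group N
  module H = Group H
  open ActionByAutomorphisms act
  open import Algebra.Properties.Group N using (identityʳ-unique)

  ▷-ε : ∀ g → g ▷ N.ε N.≈ N.ε
  ▷-ε g = identityʳ-unique (g ▷ N.ε) (g ▷ N.ε)
    (N.trans (N.sym (▷-homo g N.ε N.ε)) (▷-cong H.refl (N.identityˡ N.ε)))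

-- The additive group of the field with two elements.
C₂ : Group 0ℓ 0ℓ
C₂ = CommutativeRing.+-group xor-∧-commutativeRing

-- F₂^(k+1) / ⟨e₀ + ⋯ + e_k⟩. The generator e₀ + ⋯ + e_k is the all-ones
-- vector, so the subgroup factored out consists of the constant vectors.
C₂^_ : ℕ → Group 0ℓ 0ℓ
C₂^ k = record
  { Carrier = Fin (suc k) → Bool
  ; _≈_     = λ u v → ∃[ c ] (∀ i → u i ≡ c xor v i)
  ; _∙_     = λ u v i → u i xor v i
  ; ε       = λ _ → false
  ; _⁻¹     = λ u → u
  ; isGroup = record
    { isMonoid = record
      { isSemigroup = record
        { isMagma = record
          { isEquivalence = record
            { refl  = false , λ i → refl
            ; sym   = λ (c , p) → c , λ i →
                trans (sym (cancel c _)) (cong (c xor_) (sym (p i)))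
            ; trans = λ (c , p) (d , q) → c xor d , λ i →
                trans (p i) (trans (cong (c xor_) (q i)) (sym (assoc c d _)))
            }
          ; ∙-cong = λ {u} {u′} {v} {v′} (c , p) (d , q) → c xor d , λ i →
              trans (cong₂ _xor_ (p i) (q i)) (interchange c (u′ i) d (v′ i))
          }
        ; assoc = λ u v w → false , λ i → assoc (u i) (v i) (w i)
        }
      ; identity = (λ u → false , λ i → refl)
                 , (λ u → false , λ i → identityʳ (u i))
      }
    ; inverse = (λ u → false , λ i → inverseʳ (u i))
              , (λ u → false , λ i → inverseʳ (u i))
    ; ⁻¹-cong = λ p → p
    }
  }
  where
  open Group C₂ using (assoc; identityʳ; inverseʳ)

  cancel : ∀ c x → c xor (c xor x) ≡ x
  cancel c x = trans (sym (assoc c c x)) (cong (_xor x) (inverseʳ c))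

  open import Algebra.Properties.CommutativeSemigroup
    (CommutativeRing.+-commutativeSemigroup xor-∧-commutativeRing)
    using (interchange)

-- σ sends e_i to e_(σ i), whence the inverse on indices.
permuteBasis : ∀ k → ActionByAutomorphisms (Sym (Fin (suc k))) (C₂^ k)
permuteBasis k = record
  { _▷_        = λ σ v i → v (Inverse.from σ i)
  ; ▷-cong     = λ {σ} {τ} {u} {v} σ≈τ (c , p) → c , λ i →
      trans (p (Inverse.from σ i))
            (cong (λ j → c xor v j)
                  (Group.⁻¹-cong (Sym (Fin (suc k))) {σ} {τ} σ≈τ i))
  ; ▷-homo     = λ σ u v → false , λ i → refl
  ; ▷-assoc    = λ σ τ v → false , λ i → refl
  ; ▷-identity = λ v → false , λ i → refl
  }

-- C₂^ k ⋊S₁₊ is the semidirect product of C₂^k with S_(k+1).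
C₂^_⋊S₁₊ : ℕ → Group 0ℓ 0ℓ
C₂^ k ⋊S₁₊ = semidirectProduct (C₂^ k) (Sym (Fin (suc k))) (permuteBasis k)

------------------------------------------------------------------------
-- Labelings of the hypercube

Position : ℕ → Set
Position n = Vec Bool n

-- The label set {1,…,2ⁿ} is represented by Fin (2 ^ n), with
-- i : Fin (2 ^ n) standing for the number 1 + i.
Labeling : ℕ → Set
Labeling n = Position n ↔ Fin (2 ^ n)

module _ {n : ℕ} where

  label : Labeling n → Position n → ℕ
  label A x = suc (toℕ (Inverse.to A x))

  infix 4 _≋_

  _≋_ : Labeling n → Labeling n → Set
  A ≋ B = ∀ x → Inverse.to A x ≡ Inverse.to B x

  -- For i ≢ j, the sum of labels over the face through x whose free
  -- coordinates are i and j.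
  faceSum : Labeling n → Fin n → Fin n → Position n → ℕ
  faceSum A i j x = at false false + at false true + at true false + at true true
    where
    at : Bool → Bool → ℕ
    at a b = label A (x [ i ]≔ a [ j ]≔ b)

  MagicFaced : Pred (Labeling n) 0ℓ
  MagicFaced A = ∃[ s ] (∀ i j → i ≢ j → ∀ x → faceSum A i j x ≡ s)

  IsLine : Fin n → Position n → Position n → Set
  IsLine j x y = lookup x j ≢ lookup y j × (∀ i → i ≢ j → lookup x i ≡ lookup y i)

  HasDirection : Labeling n → Fin n → Set
  HasDirection A j = ∀ x y → IsLine j x y → label A x + label A y ≡ 2 ^ n + 1

  infixr 8 _•_

  _•_ : Position n ↔ Position n → Labeling n → Labeling n
  g • A = A ↔-∘ ↔-sym g

  IsSingleOrbit : Subgroup (Sym (Position n)) → Pred (Labeling n) 0ℓ → Set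
  IsSingleOrbit G M =
    ∃[ A ] (∀ B → M B ⇔ (∃[ g ] Subgroup.Member G g × g • A ≋ B))

magicFacedHypercubes : ℕ → Setoid 0ℓ 0ℓ
magicFacedHypercubes n = record
  { Carrier       = Σ (Labeling n) MagicFaced
  ; _≈_           = λ (A , _) (B , _) → A ≋ B
  ; isEquivalence = record
    { refl  = λ x → refl
    ; sym   = λ p x → sym (p x)
    ; trans = λ p q x → trans (p x) (q x)
    }
  }

HasCardinality : Setoid 0ℓ 0ℓ → ℕ → Set
HasCardinality S m = Inverse S (setoid (Fin m))

{-# OPTIONS --safe #-}

-- Put f = 2A − (2ⁿ + 1), where A is the labeling. The face condition says that
-- (-1)^|x| f(x) is an affine function of x, hence f is a weighted sum of the
-- n + 1 signs (-1)^|x| and (-1)^(|x| + x_i). That the labels are exactly 1,…,2ⁿ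
-- forces one weight to vanish and the others to be 1, 2, 4, …, 2^(n-1) up to
-- sign and order. For even n the sign vectors are those of product 1, and any of
-- the weights may vanish. For odd n the weight of (-1)^|x| cannot vanish; the
-- one that does belongs to the distinguished direction, and the n other signs
-- are arbitrary. The groups act by signed permutations of the sign vectors.
module Submission where

open import Defs
open import Algebra.Bundles using (Group; CommutativeRing)
open import Algebra.Construct.DirectProduct using () renaming (group to _×ᴳ_)
open import Data.Bool.Base using (Bool; true; false; _xor_; not; if_then_else_)
open import Data.Bool.Properties as Bool
  using (xor-∧-commutativeRing; xor-same; not-involutive; ¬-not; not-¬)
open import Data.Bool.Solver using (module xor-∧-Solver)
open import Data.Fin.Base as Fin using (Fin; zero; suc; toℕ; punchIn; opposite)
open import Data.Fin.Properties as Fin using (_≟_)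
open import Data.Fin.Permutation as Perm using (Permutation; _⟨$⟩ʳ_)
open import Data.Nat.Base
  using (ℕ; zero; suc; pred; _+_; _*_; _^_; _!; _≤_; _<_; _∸_; z≤n; s≤s)
open import Data.Nat.Properties hiding (_≟_)
open import Data.Nat.Divisibility using (_∣_; _∤_; divides)
open import Data.Nat.Solver using (module +-*-Solver)
open import Data.Product using (∃; ∃-syntax; Σ-syntax; ∃!; _×_; _,_; proj₁; proj₂)
open import Data.Product.Relation.Binary.Pointwise.NonDependent using (×-setoid)
open import Data.Sum.Base using (_⊎_; inj₁; inj₂)
open import Data.Vec.Base as Vec
  using (Vec; []; _∷_; lookup; tabulate; updateAt; _[_]≔_; replicate; zipWith; insertAt; removeAt)
open import Data.Vec.Properties as Vec
import Data.Vec.Functional as F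
import Data.Vec.Functional.Properties as F
open import Function.Base using (_∘_; case_of_)
open import Function.Bundles using (_↔_; _⇔_; mk⇔; mk↔ₛ′; Inverse; Equivalence)
open import Function.Construct.Composition using (_↔-∘_)
import Function.Construct.Composition as Compose
import Function.Construct.Identity as Identity
open import Function.Construct.Symmetry using (↔-sym)
open import Relation.Binary.PropositionalEquality
open import Relation.Nullary using (yes; no; does; contradiction)
open import Relation.Nullary.Decidable using (dec-true; dec-false)
open import Relation.Binary.Bundles using (Setoid)
open import Relation.Unary using (Pred)
open import Level using (0ℓ)

open import Algebra.Properties.Semiring.Sum +-*-semiring
  using (sum; sum-cong-≗; sum-remove; sum-permute; ∑-distrib-+; *-distribˡ-sum)
import Algebra.Properties.CommutativeMonoid.Sum
  (CommutativeRing.+-commutativeMonoid xor-∧-commutativeRing) as ⨁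

open ≡-Reasoning

open ⨁ using () renaming (sum to ⨁)

-- The largest label forces the vanishing weight. Moving the position labelled 1 to the origin
-- absorbs the signs of the weights: each label minus one is then a subset sum of natural weights
-- with total 2ⁿ - 1, and the position labelled 2ⁿ switches on every nonzero weight. Parity keeps it
-- from switching on all: for even n the n + 1 signs have product 1, for odd n the n signs (-1)^(|x|
-- + x_i) do, and an odd number of entries -1 has product -1. The n weights left have each of 0,
-- ..., 2ⁿ - 1 as a subset sum exactly once, and repeated halving makes them powers of 2.
--
-- The group comes from the same parity. When m is even, every class of F₂^(m+1) modulo constants
-- has a single member of even parity, so sign vectors identify the positions of an m-cube with
-- C₂^m, and signed permutations of the signs become affine maps there. For odd n this applies to
-- the (n - 1)-cube left after deleting the distinguished coordinate, which itself supplies the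
-- factor C₂.
--
-- Identities between differences are rearranged as equalities of sums so as to stay in ℕ.

private variable
  m n : ℕ

-- Parity

-- Evenness in the form in which parity arguments consume it: a constant vector of this length sums
-- to zero over F₂.
Even : ℕ → Set
Even n = ∀ c → ⨁ {n} (λ _ → c) ≡ false

2∣⇒even : 2 ∣ n → Even n
2∣⇒even (divides q refl) = go q
  where
  go : ∀ q → Even (q * 2)
  go zero    c = refl
  go (suc q) c rewrite go q c | Bool.xor-identityʳ c = xor-same c

parity : ∀ n → 2 ∣ n ⊎ ∃[ m ] (n ≡ suc m × 2 ∣ m)
parity zero = inj₁ (divides 0 refl)
parity (suc n) with parity n
... | inj₁ d                         = inj₂ (n , refl , d)
... | inj₂ (m , refl , divides q eq) = inj₁ (divides (suc q) (cong (λ k → suc (suc k)) eq))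

2∤⇒suc-even : 2 ∤ n → ∃[ m ] (n ≡ suc m × 2 ∣ m)
2∤⇒suc-even {n} 2∤n with parity n
... | inj₁ 2∣n = contradiction 2∣n 2∤n
... | inj₂ r   = r

-- The length is odd, so complementing a vector changes its parity. Hence each class modulo
-- constants has exactly one member of even parity.
⨁-shift : Even m → ∀ c (w : Fin (suc m) → Bool) → ⨁ (λ i → c xor w i) ≡ c xor ⨁ w
⨁-shift {m} even c w = trans (⨁.∑-distrib-+ (λ _ → c) w)
  (cong (_xor ⨁ w) (trans (cong (c xor_) (even c)) (Bool.xor-identityʳ c)))

-- If every entry were true the sum would be true.
⨁≡false⇒∃false : Even m → ∀ (w : Fin (suc m) → Bool) → ⨁ w ≡ false → ∃[ i ] w i ≡ false
⨁≡false⇒∃false {m} even w ⨁w with Fin.any? (λ i → w i Bool.≟ false)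
... | yes r = r
... | no ¬r = case trans (sym ⨁w) (trans (⨁.sum-cong-≗ w≗true)
                (cong not (even true))) of λ ()
  where
  w≗true : ∀ i → w i ≡ true
  w≗true i = ¬-not (λ eq → ¬r (i , eq))

-- Weighted sums of bits

bit : Bool → ℕ
bit false = 0
bit true  = 1

⟪_,_⟫ : (Fin n → ℕ) → (Fin n → Bool) → ℕ
⟪ c , u ⟫ = sum (λ i → c i * bit (u i))

⟪⟫-cong : ∀ (c : Fin n → ℕ) {u v} → u ≗ v → ⟪ c , u ⟫ ≡ ⟪ c , v ⟫
⟪⟫-cong c eq = sum-cong-≗ (λ i → cong (λ b → c i * bit b) (eq i))

⟪⟫-congˡ : ∀ {c d : Fin n → ℕ} → c ≗ d → ∀ u → ⟪ c , u ⟫ ≡ ⟪ d , u ⟫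
⟪⟫-congˡ eq u = sum-cong-≗ (λ i → cong (_* bit (u i)) (eq i))

⟪⟫-permute : ∀ (π : Permutation m n) c u →
             ⟪ c , u ⟫ ≡ ⟪ c ∘ (π ⟨$⟩ʳ_) , u ∘ (π ⟨$⟩ʳ_) ⟫
⟪⟫-permute π c u = sum-permute (λ i → c i * bit (u i)) π

⟪⟫-remove : ∀ i (c : Fin (suc n) → ℕ) u →
            ⟪ c , u ⟫ ≡ c i * bit (u i) + ⟪ c ∘ punchIn i , u ∘ punchIn i ⟫
⟪⟫-remove i c u = sum-remove {i = i} (λ i → c i * bit (u i))

-- The exemption for weight zero serves pairs on a line in the distinguished direction, where one
-- sign does not change.
⟪⟫-complement : ∀ (c : Fin n → ℕ) u v → (∀ i → c i ≡ 0 ⊎ v i ≡ not (u i)) →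
                ⟪ c , u ⟫ + ⟪ c , v ⟫ ≡ sum c
⟪⟫-complement c u v opp =
  trans (sym (∑-distrib-+ (λ i → c i * bit (u i)) (λ i → c i * bit (v i)))) (sum-cong-≗ pointwise)
  where
  pointwise : ∀ i → c i * bit (u i) + c i * bit (v i) ≡ c i
  pointwise i with opp i
  ... | inj₁ z rewrite z = refl
  ... | inj₂ eq rewrite eq with u i
  ...   | false = trans (cong (_+ c i * 1) (*-zeroʳ (c i))) (*-identityʳ (c i))
  ...   | true  = trans (cong (c i * 1 +_) (*-zeroʳ (c i))) (trans (+-identityʳ _) (*-identityʳ (c i)))

sum-const : ∀ n c → sum {n} (λ _ → c) ≡ n * c
sum-const zero    c = refl
sum-const (suc n) c = cong (c +_) (sum-const n c)

sum≡0 : ∀ (f : Fin n → ℕ) → sum f ≡ 0 → ∀ i → f i ≡ 0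
sum≡0 f eq zero    = m+n≡0⇒m≡0 (f zero) eq
sum≡0 f eq (suc i) = sum≡0 (f ∘ suc) (m+n≡0⇒n≡0 (f zero) eq) i

sum≡1 : ∀ (f : Fin n → ℕ) → sum f ≡ 1 → ∃[ i ] f i ≡ 1
sum≡1 {suc n} f eq with f zero in f₀
... | suc zero    = zero , f₀
... | zero        = let i , fi = sum≡1 (f ∘ suc) eq in suc i , fi

⟪⟫-true : ∀ (c : Fin n → ℕ) → ⟪ c , (λ _ → true) ⟫ ≡ sum c
⟪⟫-true c = sum-cong-≗ (λ i → *-identityʳ (c i))

⟪⟫-false : ∀ (c : Fin n → ℕ) → ⟪ c , (λ _ → false) ⟫ ≡ 0
⟪⟫-false {n} c = trans (sum-cong-≗ (λ i → *-zeroʳ (c i))) (trans (sum-const n 0) (*-zeroʳ n))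

-- The complement of `u` sums to 0, so no weight left out by `u` is positive. Applied at the largest
-- label, this exhibits a vanishing weight.
⟪⟫-maximal : ∀ (c : Fin n → ℕ) u → ⟪ c , u ⟫ ≡ sum c → ∀ i → u i ≡ false → c i ≡ 0
⟪⟫-maximal c u eq i ui = begin
  c i                    ≡⟨ *-identityʳ (c i) ⟨
  c i * 1                ≡⟨ cong (λ b → c i * bit (not b)) ui ⟨
  c i * bit (not (u i))  ≡⟨ sum≡0 _ rest≡0 i ⟩
  0                      ∎
  where
  rest≡0 : ⟪ c , not ∘ u ⟫ ≡ 0
  rest≡0 = +-cancelˡ-≡ ⟪ c , u ⟫ _ _ (trans (⟪⟫-complement c u (not ∘ u) (λ _ → inj₂ refl))
    (trans (sym eq) (sym (+-identityʳ _))))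

-- Subset sums

powers : Fin n → ℕ
powers k = 2 ^ toℕ k

-- Taking subset sums is a bijection onto 0, ..., 2ⁿ - 1. This is all that bijectivity of a labeling
-- says about its n surviving weights.
record Exhaustive (c : Fin n → ℕ) : Set where
  field
    bounded   : ∀ u → ⟪ c , u ⟫ < 2 ^ n
    injective : ∀ u v → ⟪ c , u ⟫ ≡ ⟪ c , v ⟫ → u ≗ v
    covering  : ∀ {k} → k < 2 ^ n → ∃[ u ] ⟪ c , u ⟫ ≡ k

⟪⟫-insertAt : ∀ (c : Fin (suc n) → ℕ) i b u →
  ⟪ c , F.insertAt u i b ⟫ ≡ c i * bit b + ⟪ c ∘ punchIn i , u ⟫
⟪⟫-insertAt c i b u = trans (⟪⟫-remove i c (F.insertAt u i b))
  (cong₂ (λ b′ r → c i * bit b′ + r) (F.insertAt-lookup u i b)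
         (⟪⟫-cong (c ∘ punchIn i) (F.insertAt-punchIn u i b)))

module _ {n} (c : Fin (suc n) → ℕ) (E : Exhaustive c)
         (i : Fin (suc n)) (ci≡1 : c i ≡ 1) where
  open Exhaustive E

  private
    r : Fin n → ℕ
    r = c ∘ punchIn i

    insert-sum : ∀ b u → ⟪ c , F.insertAt u i b ⟫ ≡ bit b + ⟪ r , u ⟫
    insert-sum b u = trans (⟪⟫-insertAt c i b u)
      (cong (_+ ⟪ r , u ⟫) (trans (cong (_* bit b) ci≡1) (+-identityʳ (bit b))))

    split : ∀ u → ⟪ c , u ⟫ ≡ bit (u i) + ⟪ r , u ∘ punchIn i ⟫
    split u = trans (⟪⟫-remove i c u)
      (cong (_+ ⟪ r , u ∘ punchIn i ⟫) (trans (cong (_* bit (u i)) ci≡1) (+-identityʳ _)))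

    bounded′ : ∀ u → ⟪ r , u ⟫ < 2 ^ suc n
    bounded′ u = subst (_< _) (insert-sum false u) (bounded (F.insertAt u i false))

    -- Adding the weight 1 to `v` would give the sum that `u` gives without it, against injectivity.
    not-successive : ∀ u v → ⟪ r , u ⟫ ≢ suc ⟪ r , v ⟫
    not-successive u v eq = case false≡true of λ ()
      where
      false≡true : false ≡ true
      false≡true = begin
        false                      ≡⟨ F.insertAt-lookup u i false ⟨
        F.insertAt u i false i     ≡⟨ injective (F.insertAt u i false) (F.insertAt v i true) (trans (insert-sum false u) (trans eq (sym (insert-sum true v)))) i ⟩
        F.insertAt v i true i      ≡⟨ F.insertAt-lookup v i true ⟩
        true                       ∎

    -- The sums of the remaining weights and their successors partition
    -- the range, hence the former are exactly the even numbers.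
    not-odd : ∀ k u → ⟪ r , u ⟫ ≢ suc (2 * k)
    not-odd zero    u eq = not-successive u (λ _ → false) (trans eq (cong suc (sym (⟪⟫-false r))))
    -- The predecessor 2k + 2 is a subset sum of `c`. Without the weight 1 it yields two successive
    -- sums of `r`; with it, the smaller odd sum 2k + 1.
    not-odd (suc k) u eq with covering {2 * suc k} (<-trans (n<1+n _) (subst (_< _) eq (bounded′ u)))
    ... | w , eqw with w i | split w
    ...   | false | s = not-successive u (w ∘ punchIn i) (trans eq (cong suc (trans (sym eqw) s)))
    ...   | true  | s = not-odd k (w ∘ punchIn i) (suc-injective (trans (sym s) (trans eqw (cong suc (+-suc k (k + 0))))))

    halving : ∀ k → (∃[ h ] k ≡ 2 * h) ⊎ (∃[ h ] k ≡ suc (2 * h))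
    halving zero    = inj₁ (0 , refl)
    halving (suc k) with halving k
    ... | inj₁ (h , eq) = inj₂ (h , cong suc eq)
    ... | inj₂ (h , eq) = inj₁ (suc h , cong suc (trans eq (sym (+-suc h (h + 0)))))

    single : ∀ k → r k ≡ ⟪ r , (λ l → does (k ≟ l)) ⟫
    single k = go r k
      where
      go : ∀ {n} (r : Fin n → ℕ) k → r k ≡ ⟪ r , (λ l → does (k ≟ l)) ⟫
      go r zero    = sym (trans (cong₂ _+_ (*-identityʳ (r zero)) (⟪⟫-false (r ∘ suc))) (+-identityʳ _))
      go r (suc k) = trans (go (r ∘ suc) k) (cong (_+ ⟪ r ∘ suc , (λ l → does (k ≟ l)) ⟫) (sym (*-zeroʳ (r zero))))

    even : ∀ k → ∃[ h ] r k ≡ 2 * h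
    even k with halving (r k)
    ... | inj₁ p        = p
    ... | inj₂ (h , eq) = contradiction (trans (sym (single k)) eq) (not-odd h _)

  half : Fin n → ℕ
  half k = proj₁ (even k)

  half-spec : ∀ k → r k ≡ 2 * half k
  half-spec k = proj₂ (even k)

  private
    double : ∀ u → ⟪ r , u ⟫ ≡ 2 * ⟪ half , u ⟫
    double u = trans (sum-cong-≗ (λ k → trans (cong (_* bit (u k)) (half-spec k)) (*-assoc 2 (half k) _)))
                     (sym (*-distribˡ-sum 2 (λ k → half k * bit (u k))))

  -- Leaving out the weight 1 embeds the doubled sums of `half` among the sums of `c`, which gives
  -- the bound and injectivity. For covering, a representation of 2k in `c` cannot use the weight 1,
  -- as the rest would be odd.
  half-exhaustive : Exhaustive half
  half-exhaustive = record
    { bounded   = λ u → *-cancelˡ-< 2 _ _ (subst (_< _) (double u) (bounded′ u))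
    ; injective = λ u v eq k → begin
        u k                                  ≡⟨ F.insertAt-punchIn u i false k ⟨
        F.insertAt u i false (punchIn i k)   ≡⟨ injective (F.insertAt u i false) (F.insertAt v i false) (trans (insert-sum false u) (trans (double u)
                                                  (trans (cong (2 *_) eq) (sym (trans (insert-sum false v) (double v)))))) (punchIn i k) ⟩
        F.insertAt v i false (punchIn i k)   ≡⟨ F.insertAt-punchIn v i false k ⟩
        v k                                  ∎
    ; covering  = cover
    }
    where
    cover : ∀ {k} → k < 2 ^ n → ∃[ u ] ⟪ half , u ⟫ ≡ k
    cover {k} k< with covering {2 * k} (*-monoʳ-< 2 k<)
    ... | w , eqw with w i | split w
    ...   | false | s = w ∘ punchIn i , *-cancelˡ-≡ _ k 2 (trans (sym (double _)) (trans (sym s) eqw))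
    ...   | true  | s with k
    ...     | zero   = case trans (sym s) eqw of λ ()
    ...     | suc k′ = contradiction (suc-injective (trans (sym s) (trans eqw (cong suc (+-suc k′ (k′ + 0))))))
                         (not-odd k′ (w ∘ punchIn i))

-- The number 1 is a subset sum, so some weight equals 1. The others are even and their halves are
-- again exhaustive.
exhaustive⇒powers : ∀ (c : Fin n → ℕ) → Exhaustive c →
                    ∃[ ρ ] c ∘ (ρ ⟨$⟩ʳ_) ≗ powers {n}
exhaustive⇒powers {zero}  c E = Perm.id , λ ()
exhaustive⇒powers {suc n} c E with Exhaustive.covering E {1} (^-monoʳ-≤ 2 {1} {suc n} (s≤s z≤n))
... | u , eq with sum≡1 _ eq
...   | i , eqi with m*n≡1⇒m≡1 (c i) (bit (u i)) eqi
...     | ci≡1 with exhaustive⇒powers (half c E i ci≡1) (half-exhaustive c E i ci≡1)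
...       | ρ , c∘ρ = Perm.insert zero i ρ , λ where
  zero    → ci≡1
  (suc k) → trans (cong c (Perm.insert-punchIn zero i ρ k))
              (trans (half-spec c E i ci≡1 (ρ ⟨$⟩ʳ k)) (cong (2 *_) (c∘ρ k)))

-- Faces in terms of coordinate flips

lookup-ext : ∀ {A : Set} {x y : Vec A n} → lookup x ≗ lookup y → x ≡ y
lookup-ext {x = x} {y} eq = begin
  x                    ≡⟨ Vec.tabulate∘lookup x ⟨
  tabulate (lookup x)  ≡⟨ Vec.tabulate-cong eq ⟩
  tabulate (lookup y)  ≡⟨ Vec.tabulate∘lookup y ⟩
  y                    ∎

flip : Fin n → Position n → Position n
flip i x = updateAt x i not

flip-comm : ∀ (i j : Fin n) x → flip i (flip j x) ≡ flip j (flip i x)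
flip-comm i j x with i ≟ j
... | yes refl = refl
... | no i≢j   = updateAt-commutes i j i≢j x

flip-involutive : ∀ (i : Fin n) x → flip i (flip i x) ≡ x
flip-involutive i x = trans (updateAt-updateAt i x)
  (updateAt-id-local i x (not-involutive _))

flip-↔ : Fin n → Position n ↔ Position n
flip-↔ i = mk↔ₛ′ (flip i) (flip i) (flip-involutive i) (flip-involutive i)

flip-≔ : ∀ (i : Fin n) x → x [ i ]≔ not (lookup x i) ≡ flip i x
flip-≔ i x = updateAt-cong-local i x refl

-- Which corner of the face is `x` itself depends on its two free bits, whence the four reorderings.
face-flips : ∀ {i j : Fin n} → i ≢ j → ∀ (f : Position n → ℕ) x →
  f (x [ i ]≔ false [ j ]≔ false) + f (x [ i ]≔ false [ j ]≔ true)
    + f (x [ i ]≔ true [ j ]≔ false) + f (x [ i ]≔ true [ j ]≔ true)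
  ≡ f x + f (flip i x) + f (flip j x) + f (flip i (flip j x))
face-flips {n} {i} {j} i≢j f x = reorder (lookup x i) (lookup x j)
  (cong f (trans (cong (_[ j ]≔ lookup x j) ([]≔-lookup x i)) ([]≔-lookup x j)))
  (cong f (trans (cong (_[ j ]≔ lookup x j) (flip-≔ i x))
    (updateAt-id-local j (flip i x) (sym (lookup∘updateAt′ j i (i≢j ∘ sym) x)))))
  (cong f (trans (cong (_[ j ]≔ not (lookup x j)) ([]≔-lookup x i)) (flip-≔ j x)))
  (cong f (trans (cong (_[ j ]≔ not (lookup x j)) (flip-≔ i x))
    (trans (updateAt-cong-local j (flip i x) (cong not (sym (lookup∘updateAt′ j i (i≢j ∘ sym) x))))
           (flip-comm j i x))))
  where
  open +-*-Solver
  at : Bool → Bool → ℕ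
  at a b = f (x [ i ]≔ a [ j ]≔ b)

  reorder : ∀ a b {p q r s} → at a b ≡ p → at (not a) b ≡ q → at a (not b) ≡ r → at (not a) (not b) ≡ s →
    at false false + at false true + at true false + at true true ≡ p + q + r + s
  reorder false false refl refl refl refl =
    solve 4 (λ a b c d → a :+ b :+ c :+ d := a :+ c :+ b :+ d) refl (at false false) (at false true) (at true false) (at true true)
  reorder false true  refl refl refl refl =
    solve 4 (λ a b c d → a :+ b :+ c :+ d := b :+ d :+ a :+ c) refl (at false false) (at false true) (at true false) (at true true)
  reorder true  false refl refl refl refl =
    solve 4 (λ a b c d → a :+ b :+ c :+ d := c :+ a :+ d :+ b) refl (at false false) (at false true) (at true false) (at true true)
  reorder true  true  refl refl refl refl =
    solve 4 (λ a b c d → a :+ b :+ c :+ d := d :+ b :+ c :+ a) refl (at false false) (at false true) (at true false) (at true true)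

value : Labeling n → Position n → ℕ
value A x = toℕ (Inverse.to A x)

value-injective : ∀ (A : Labeling n) {x y} → value A x ≡ value A y → x ≡ y
value-injective A {x} {y} eq = begin
  x                                   ≡⟨ Inverse.strictlyInverseʳ A x ⟨
  Inverse.from A (Inverse.to A x)     ≡⟨ cong (Inverse.from A) (Fin.toℕ-injective eq) ⟩
  Inverse.from A (Inverse.to A y)     ≡⟨ Inverse.strictlyInverseʳ A y ⟩
  y                                   ∎

value-surjective : ∀ (A : Labeling n) {k} → k < 2 ^ n → ∃[ x ] value A x ≡ k
value-surjective A k< = Inverse.from A (Fin.fromℕ< k<) ,
  trans (cong toℕ (Inverse.strictlyInverseˡ A _)) (Fin.toℕ-fromℕ< k<)

suc-opposite : ∀ (k : Fin n) → suc (toℕ k + toℕ (opposite k)) ≡ n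
suc-opposite k = trans (cong (suc (toℕ k) +_) (Fin.opposite-prop k)) (m+[n∸m]≡n (Fin.toℕ<n k))

-- With T the sum of all labels, averaging over the faces in directions i and j
-- gives 4T = 2ⁿs, and reversing the order of the labels gives 2T = 2ⁿ(2ⁿ + 1).
magic-constant : ∀ {A : Labeling n} → MagicFaced A → ∀ i j → i ≢ j → ∀ x →
  label A x + label A (flip i x) + label A (flip j x) + label A (flip i (flip j x)) ≡ 2 * suc (2 ^ n)
magic-constant {n} {A} (s , magic) i j i≢j x =
  trans (sym (face-flips i≢j (label A) x)) (trans (magic i j i≢j x) s≡)
  where
  open +-*-Solver
  N = 2 ^ n
  pos = Inverse.from A

  ∑ : (Position n → ℕ) → ℕ
  ∑ f = sum (f ∘ pos)

  ∑-flip : ∀ k f → ∑ f ≡ ∑ (f ∘ flip k)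
  ∑-flip k f = trans (sum-permute (f ∘ pos) (A ↔-∘ (flip-↔ k ↔-∘ ↔-sym A)))
    (sum-cong-≗ {N} λ l → cong f (Inverse.strictlyInverseʳ A (flip k (pos l))))

  ∑-+ : ∀ f g → ∑ (λ y → f y + g y) ≡ ∑ f + ∑ g
  ∑-+ f g = ∑-distrib-+ (f ∘ pos) (g ∘ pos)

  T = ∑ (label A)

  four-T : T + T + T + T ≡ N * s
  four-T = begin
    T + T + T + T
      ≡⟨ cong₂ _+_ (cong₂ _+_ (cong (T +_) (∑-flip i (label A))) (∑-flip j (label A)))
                (trans (∑-flip i (label A)) (∑-flip j (label A ∘ flip i))) ⟩
    T + ∑ (label A ∘ flip i) + ∑ (label A ∘ flip j) + ∑ (label A ∘ flip i ∘ flip j)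
      ≡⟨ cong (λ t → t + ∑ (label A ∘ flip j) + ∑ (label A ∘ flip i ∘ flip j)) (∑-+ (label A) (label A ∘ flip i)) ⟨
    ∑ (λ y → label A y + label A (flip i y)) + ∑ (label A ∘ flip j) + ∑ (label A ∘ flip i ∘ flip j)
      ≡⟨ cong (_+ ∑ (label A ∘ flip i ∘ flip j))
           (∑-+ (λ y → label A y + label A (flip i y)) (label A ∘ flip j)) ⟨
    ∑ (λ y → label A y + label A (flip i y) + label A (flip j y)) + ∑ (label A ∘ flip i ∘ flip j)
      ≡⟨ ∑-+ (λ y → label A y + label A (flip i y) + label A (flip j y)) (label A ∘ flip i ∘ flip j) ⟨
    ∑ (λ y → label A y + label A (flip i y) + label A (flip j y) + label A (flip i (flip j y)))
      ≡⟨ sum-cong-≗ (λ k → trans (sym (face-flips i≢j (label A) (pos k))) (magic i j i≢j (pos k))) ⟩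
    sum {N} (λ _ → s)
      ≡⟨ sum-const N s ⟩
    N * s ∎

  T≡ : T ≡ sum {N} (suc ∘ toℕ)
  T≡ = sum-cong-≗ (λ k → cong (suc ∘ toℕ) (Inverse.strictlyInverseˡ A k))

  two-T : T + T ≡ N * suc N
  two-T = begin
    T + T
      ≡⟨ cong₂ _+_ T≡ (trans T≡ (sum-permute {N} (suc ∘ toℕ) Perm.reverse)) ⟩
    sum {N} (suc ∘ toℕ) + sum {N} (suc ∘ toℕ ∘ opposite)
      ≡⟨ ∑-distrib-+ {N} (suc ∘ toℕ) (suc ∘ toℕ ∘ opposite) ⟨
    sum {N} (λ k → suc (toℕ k) + suc (toℕ (opposite k)))
      ≡⟨ sum-cong-≗ {N} (λ k → trans (+-suc (suc (toℕ k)) _) (cong suc (suc-opposite k))) ⟩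
    sum {N} (λ _ → suc N)
      ≡⟨ sum-const N (suc N) ⟩
    N * suc N ∎

  s≡ : s ≡ 2 * suc N
  s≡ = *-cancelˡ-≡ s (2 * suc N) N {{m^n≢0 2 n}} (begin
    N * s                  ≡⟨ four-T ⟨
    T + T + T + T          ≡⟨ +-assoc (T + T) T T ⟩
    (T + T) + (T + T)      ≡⟨ cong₂ _+_ two-T two-T ⟩
    N * suc N + N * suc N  ≡⟨ solve 2 (λ a b → a :* b :+ a :* b := a :* (con 2 :* b)) refl N (suc N) ⟩
    N * (2 * suc N)        ∎)

-- Signs

-- The signs (-1)^|x| (entry zero) and (-1)^(|x| + x_i), with true for −1.
sign : Position n → Fin (suc n) → Bool
sign x i = ⨁ (lookup x) xor lookup (false ∷ x) i

xor-not : ∀ a b → a xor not b ≡ not (a xor b)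
xor-not a b = sym (Bool.not-distribʳ-xor a b)

⨁-flip : ∀ (i : Fin n) x → ⨁ (lookup (flip i x)) ≡ not (⨁ (lookup x))
⨁-flip zero    (b ∷ x) = sym (Bool.not-distribˡ-xor b _)
⨁-flip (suc i) (b ∷ x) = trans (cong (b xor_) (⨁-flip i x)) (xor-not b _)

-- The flip changes both |x| and x_i, and the two changes cancel in this sign alone; every other
-- sign sees only the change of |x|.
sign-flip-suc : ∀ (i : Fin n) x → sign (flip i x) (suc i) ≡ sign x (suc i)
sign-flip-suc i x = trans (cong₂ _xor_ (⨁-flip i x) (lookup∘updateAt i x))
  (Bool.xor-annihilates-not (⨁ (lookup x)) (lookup x i))

sign-flip : ∀ (i : Fin n) {k} → k ≢ suc i → ∀ x → sign (flip i x) k ≡ not (sign x k)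
sign-flip i {k} k≢ x = trans (cong₂ _xor_ (⨁-flip i x) (same k k≢)) (sym (Bool.not-distribˡ-xor (⨁ (lookup x)) (lookup (false ∷ x) k)))
  where
  same : ∀ k → k ≢ suc i → lookup (false ∷ flip i x) k ≡ lookup (false ∷ x) k
  same zero    _  = refl
  same (suc k) k≢ = lookup∘updateAt′ k i (k≢ ∘ cong suc) x

⟪⟫-four : ∀ (t : Fin n → ℕ) u₁ u₂ u₃ u₄ →
  (∀ k → bit (u₁ k) + bit (u₂ k) + bit (u₃ k) + bit (u₄ k) ≡ 2) →
  ⟪ t , u₁ ⟫ + ⟪ t , u₂ ⟫ + ⟪ t , u₃ ⟫ + ⟪ t , u₄ ⟫ ≡ sum t * 2
⟪⟫-four {zero}  t u₁ u₂ u₃ u₄ two = refl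
⟪⟫-four {suc n} t u₁ u₂ u₃ u₄ two = begin
  ⟪ t , u₁ ⟫ + ⟪ t , u₂ ⟫ + ⟪ t , u₃ ⟫ + ⟪ t , u₄ ⟫
    ≡⟨ solve 9 (λ x a b c d e f g h → (x :* a :+ e) :+ (x :* b :+ f) :+ (x :* c :+ g) :+ (x :* d :+ h)
         := x :* (a :+ b :+ c :+ d) :+ (e :+ f :+ g :+ h)) refl
         (t zero) (bit (u₁ zero)) (bit (u₂ zero)) (bit (u₃ zero)) (bit (u₄ zero)) _ _ _ _ ⟩
  t zero * (bit (u₁ zero) + bit (u₂ zero) + bit (u₃ zero) + bit (u₄ zero)) + _
    ≡⟨ cong₂ (λ b r → t zero * b + r) (two zero) (⟪⟫-four (t ∘ suc) _ _ _ _ (two ∘ suc)) ⟩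
  t zero * 2 + sum (t ∘ suc) * 2
    ≡⟨ *-distribʳ-+ 2 (t zero) _ ⟨
  sum t * 2 ∎
  where open +-*-Solver

two-of-four : ∀ {a b c d} → (b ≡ not a × d ≡ not c) ⊎ (c ≡ not a × d ≡ not b) →
              bit a + bit b + bit c + bit d ≡ 2
two-of-four {false} {c = false} (inj₁ (refl , refl)) = refl
two-of-four {false} {c = true}  (inj₁ (refl , refl)) = refl
two-of-four {true}  {c = false} (inj₁ (refl , refl)) = refl
two-of-four {true}  {c = true}  (inj₁ (refl , refl)) = refl
two-of-four {false} {b = false} (inj₂ (refl , refl)) = refl
two-of-four {false} {b = true}  (inj₂ (refl , refl)) = refl
two-of-four {true}  {b = false} (inj₂ (refl , refl)) = refl
two-of-four {true}  {b = true}  (inj₂ (refl , refl)) = refl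

-- On a face in directions i and j, a sign changes along i unless it belongs to i, and then it
-- changes along j. Either way each weight is counted at exactly two corners. The summand 4 converts
-- values to labels.
signed⇒magic : ∀ (B : Labeling n) (t : Fin m → ℕ) (a : Fin m → Bool) (s : Fin m → Fin (suc n)) →
  (∀ x → value B x ≡ ⟪ t , (λ k → a k xor sign x (s k)) ⟫) → MagicFaced B
signed⇒magic {n} {m} B t a s eq = 4 + sum t * 2 , λ i j i≢j x → begin
  faceSum B i j x
    ≡⟨ face-flips i≢j (label B) x ⟩
  label B x + label B (flip i x) + label B (flip j x) + label B (flip i (flip j x))
    ≡⟨ sucs (value B x) (value B (flip i x)) (value B (flip j x)) (value B (flip i (flip j x))) ⟩
  4 + (value B x + value B (flip i x) + value B (flip j x) + value B (flip i (flip j x)))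
    ≡⟨ cong (4 +_) (cong₂ _+_ (cong₂ _+_ (cong₂ _+_ (eq x) (eq (flip i x))) (eq (flip j x))) (eq (flip i (flip j x)))) ⟩
  4 + (⟪ t , σ x ⟫ + ⟪ t , σ (flip i x) ⟫ + ⟪ t , σ (flip j x) ⟫ + ⟪ t , σ (flip i (flip j x)) ⟫)
    ≡⟨ cong (4 +_) (⟪⟫-four t (σ x) (σ (flip i x)) (σ (flip j x)) (σ (flip i (flip j x)))
         (λ k → two-of-four {σ x k} {σ (flip i x) k} {σ (flip j x) k} (pair i j i≢j x k))) ⟩
  4 + sum t * 2 ∎
  where
  sucs : ∀ a b c d → suc a + suc b + suc c + suc d ≡ 4 + (a + b + c + d)
  sucs = solve 4 (λ a b c d → con 1 :+ a :+ (con 1 :+ b) :+ (con 1 :+ c) :+ (con 1 :+ d)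
           := con 4 :+ (a :+ b :+ c :+ d)) refl
    where open +-*-Solver

  σ : Position n → Fin m → Bool
  σ x k = a k xor sign x (s k)

  σ-flip : ∀ i x k → s k ≢ suc i → σ (flip i x) k ≡ not (σ x k)
  σ-flip i x k ≢i = trans (cong (a k xor_) (sign-flip i ≢i x)) (xor-not (a k) (sign x (s k)))

  pair : ∀ i j → i ≢ j → ∀ x k →
    (σ (flip i x) k ≡ not (σ x k) × σ (flip i (flip j x)) k ≡ not (σ (flip j x) k)) ⊎
    (σ (flip j x) k ≡ not (σ x k) × σ (flip i (flip j x)) k ≡ not (σ (flip i x) k))
  pair i j i≢j x k with s k ≟ suc i
  ... | no  ≢i = inj₁ (σ-flip i x k ≢i , σ-flip i (flip j x) k ≢i)
  ... | yes ≡i = inj₂ (σ-flip j x k ≢j , trans (cong (λ y → σ y k) (flip-comm i j x)) (σ-flip j (flip i x) k ≢j))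
    where
    ≢j : s k ≢ suc j
    ≢j ≡j = i≢j (Fin.suc-injective (trans (sym ≡i) ≡j))

-- Second differences

zeros : Position n
zeros {n} = replicate n false

lookup-zeros : ∀ (i : Fin n) → lookup zeros i ≡ false
lookup-zeros i = lookup-replicate i false

-- Vanishing of the mixed second differences of `h`.
Square : (Position n → ℕ) → Set
Square {n} h = ∀ (i j : Fin n) → i ≢ j → ∀ x → h x + h (flip i (flip j x)) ≡ h (flip i x) + h (flip j x)

-- The hypothesis says that g′ - g agrees at neighbours, and flips join every position to the
-- origin.
difference-constant : ∀ (g g′ : Position n → ℕ) →
  (∀ j x → g x + g′ (flip j x) ≡ g′ x + g (flip j x)) →
  ∀ x → g′ x + g zeros ≡ g x + g′ zeros
difference-constant g g′ eq [] = +-comm (g′ []) (g [])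
difference-constant g g′ eq (false ∷ x) =
  difference-constant (g ∘ (false ∷_)) (g′ ∘ (false ∷_)) (λ j y → eq (suc j) (false ∷ y)) x
difference-constant g g′ eq (true ∷ x) =
  +-cancelˡ-≡ (g (false ∷ x) + g′ (false ∷ x)) _ _ (begin
    g (false ∷ x) + g′ (false ∷ x) + (g′ (true ∷ x) + g zeros)
      ≡⟨ solve 4 (λ a b c d → a :+ b :+ (c :+ d) := (a :+ c) :+ (b :+ d)) refl (g (false ∷ x)) (g′ (false ∷ x)) (g′ (true ∷ x)) (g zeros) ⟩
    (g (false ∷ x) + g′ (true ∷ x)) + (g′ (false ∷ x) + g zeros)
      ≡⟨ cong₂ _+_ (eq zero (false ∷ x))
           (difference-constant (g ∘ (false ∷_)) (g′ ∘ (false ∷_)) (λ j y → eq (suc j) (false ∷ y)) x) ⟩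
    (g′ (false ∷ x) + g (true ∷ x)) + (g (false ∷ x) + g′ zeros)
      ≡⟨ solve 4 (λ a b c d → (b :+ c) :+ (a :+ d) := a :+ b :+ (c :+ d)) refl (g (false ∷ x)) (g′ (false ∷ x)) (g (true ∷ x)) (g′ zeros) ⟩
    g (false ∷ x) + g′ (false ∷ x) + (g (true ∷ x) + g′ zeros) ∎)
  where open +-*-Solver

-- By induction on the dimension: the two slices in the first coordinate differ by a constant, which
-- is read off at the origin.
square⇒linear : ∀ (h : Position n → ℕ) → Square h → h zeros ≡ 0 →
  ∀ x → h x ≡ ⟪ (λ i → h (flip i zeros)) , lookup x ⟫
square⇒linear h sq h₀ [] = h₀
square⇒linear {suc n} h sq h₀ (b ∷ x) = begin
  h (b ∷ x)                                            ≡⟨ head-step b ⟩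
  h (true ∷ zeros) * bit b + h (false ∷ x)             ≡⟨ cong (h (true ∷ zeros) * bit b +_) IH ⟩
  ⟪ (λ i → h (flip i zeros)) , lookup (b ∷ x) ⟫ ∎
  where
  IH = square⇒linear (h ∘ (false ∷_)) (λ i j i≢j y → sq (suc i) (suc j) (i≢j ∘ Fin.suc-injective) (false ∷ y)) h₀ x

  head-step : ∀ b → h (b ∷ x) ≡ h (true ∷ zeros) * bit b + h (false ∷ x)
  head-step false = cong (_+ h (false ∷ x)) (sym (*-zeroʳ (h (true ∷ zeros))))
  head-step true  = begin
    h (true ∷ x)                            ≡⟨ +-identityʳ _ ⟨
    h (true ∷ x) + 0                        ≡⟨ cong (h (true ∷ x) +_) h₀ ⟨
    h (true ∷ x) + h zeros                  ≡⟨ difference-constant (h ∘ (false ∷_)) (h ∘ (true ∷_)) (λ j y → sq zero (suc j) (λ ()) (false ∷ y)) x ⟩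
    h (false ∷ x) + h (true ∷ zeros)        ≡⟨ +-comm (h (false ∷ x)) _ ⟩
    h (true ∷ zeros) + h (false ∷ x)        ≡⟨ cong (_+ h (false ∷ x)) (*-identityʳ _) ⟨
    h (true ∷ zeros) * 1 + h (false ∷ x)    ∎

-- Translations

infixl 6 _⊕_

_⊕_ : Position n → Position n → Position n
_⊕_ = zipWith _xor_

xor-interchange : ∀ a b c d → (a xor b) xor (c xor d) ≡ (b xor d) xor (a xor c)
xor-interchange = solve 4 (λ a b c d → (a :+ b) :+ (c :+ d) := (b :+ d) :+ (a :+ c)) refl
  where open xor-∧-Solver

⨁-⊕ : ∀ (x a : Position n) → ⨁ (lookup (x ⊕ a)) ≡ ⨁ (lookup x) xor ⨁ (lookup a)
⨁-⊕ x a = trans (⨁.sum-cong-≗ (λ i → lookup-zipWith _xor_ i x a)) (⨁.∑-distrib-+ (lookup x) (lookup a))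

sign-⊕ : ∀ (x a : Position n) k → sign (x ⊕ a) k ≡ sign a k xor sign x k
sign-⊕ x a k = trans (cong₂ _xor_ (⨁-⊕ x a) (entry k))
  (xor-interchange (⨁ (lookup x)) (⨁ (lookup a)) (lookup (false ∷ x) k) (lookup (false ∷ a) k))
  where
  entry : ∀ k → lookup (false ∷ (x ⊕ a)) k ≡ lookup (false ∷ x) k xor lookup (false ∷ a) k
  entry zero    = refl
  entry (suc i) = lookup-zipWith _xor_ i x a

flip-⊕ : ∀ (i : Fin n) x a → flip i x ⊕ a ≡ flip i (x ⊕ a)
flip-⊕ zero    (b ∷ x) (c ∷ a) = cong (_∷ (x ⊕ a)) (sym (Bool.not-distribˡ-xor b c))
flip-⊕ (suc i) (b ∷ x) (c ∷ a) = cong ((b xor c) ∷_) (flip-⊕ i x a)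

zeros-⊕ : ∀ (a : Position n) → zeros ⊕ a ≡ a
zeros-⊕ []      = refl
zeros-⊕ (b ∷ a) = cong (b ∷_) (zeros-⊕ a)

⊕-involutive : ∀ (x a : Position n) → (x ⊕ a) ⊕ a ≡ x
⊕-involutive []      []      = refl
⊕-involutive (b ∷ x) (c ∷ a) = cong₂ _∷_
  (trans (Bool.xor-assoc b c c) (trans (cong (b xor_) (xor-same c)) (Bool.xor-identityʳ b))) (⊕-involutive x a)

⨁-zeros : ∀ n → ⨁ (lookup (zeros {n})) ≡ false
⨁-zeros zero    = refl
⨁-zeros (suc n) = ⨁-zeros n

-- At `base` all bits are false, so its label is 1 and the weights can be natural numbers. `total`
-- makes their sum the largest value.
record NormalForm (B : Labeling n) : Set where
  field
    base  : Position n
    coeff : Fin (suc n) → ℕ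
    total : suc (sum coeff) ≡ 2 ^ n
    spec  : ∀ x → value B (x ⊕ base) ≡ ⟪ coeff , sign x ⟫

-- With the label 1 at the base point and the labels at odd distance from
-- it reflected, the face condition says that second differences vanish.
magic⇒normalForm : ∀ (B : Labeling n) → MagicFaced B → NormalForm B
magic⇒normalForm {n} B magic = record
  { base  = a
  ; coeff = c
  ; total = total
  ; spec  = λ x → spec x (⨁ (lookup x)) refl
  }
  where
  N = 2 ^ n
  a = proj₁ (value-surjective B (m^n>0 2 n))

  v : Position n → ℕ
  v x = value B (x ⊕ a)

  h : Position n → ℕ
  h x = toℕ (if ⨁ (lookup x) then opposite (Inverse.to B (x ⊕ a)) else Inverse.to B (x ⊕ a))

  h-even : ∀ x → ⨁ (lookup x) ≡ false → h x ≡ v x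
  h-even x eq rewrite eq = refl

  h-odd : ∀ x → ⨁ (lookup x) ≡ true → suc (v x + h x) ≡ N
  h-odd x eq rewrite eq = suc-opposite (Inverse.to B (x ⊕ a))

  h-zeros : h zeros ≡ 0
  h-zeros = trans (h-even zeros (⨁-zeros n)) (trans (cong (value B) (zeros-⊕ a))
    (proj₂ (value-surjective B (m^n>0 2 n))))

  flips : ∀ i j → i ≢ j → ∀ x →
    suc (v x) + suc (v (flip i x)) + suc (v (flip j x)) + suc (v (flip i (flip j x))) ≡ 2 * suc N
  flips i j i≢j x = trans
    (cong₂ _+_ (cong₂ _+_ (cong (suc (v x) +_) (s (flip-⊕ i x a))) (s (flip-⊕ j x a)))
      (s (trans (flip-⊕ i (flip j x) a) (cong (flip i) (flip-⊕ j x a)))))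
    (magic-constant {A = B} magic i j i≢j (x ⊕ a))
    where
    s : ∀ {x y} → x ≡ y → label B x ≡ label B y
    s = cong (label B)

  balance : ∀ p q r s {q′ r′} → suc p + suc q + suc r + suc s ≡ 2 * suc N →
            suc (q + q′) ≡ N → suc (r + r′) ≡ N → p + s ≡ q′ + r′
  balance p q r s {q′} {r′} eq eq₁ eq₂ = +-cancelˡ-≡ (4 + (q + r)) _ _ (begin
    4 + (q + r) + (p + s)                    ≡⟨ solve 4 (λ p q r s → con 4 :+ (q :+ r) :+ (p :+ s) := con 1 :+ p :+ (con 1 :+ q) :+ (con 1 :+ r) :+ (con 1 :+ s)) refl p q r s ⟩
    suc p + suc q + suc r + suc s            ≡⟨ eq ⟩
    2 * suc N                                ≡⟨ solve 1 (λ x → con 2 :* (con 1 :+ x) := con 2 :+ (x :+ x)) refl N ⟩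
    2 + (N + N)                              ≡⟨ cong (2 +_) (cong₂ _+_ eq₁ eq₂) ⟨
    2 + (suc (q + q′) + suc (r + r′))        ≡⟨ solve 4 (λ q q′ r r′ → con 2 :+ ((con 1 :+ (q :+ q′)) :+ (con 1 :+ (r :+ r′))) := con 4 :+ (q :+ r) :+ (q′ :+ r′)) refl q q′ r r′ ⟩
    4 + (q + r) + (q′ + r′)                  ∎)
    where open +-*-Solver

  square : Square h
  square i j i≢j x = by-parity (⨁ (lookup x)) refl
    where
    open +-*-Solver
    p : ∀ k {b} → ⨁ (lookup x) ≡ b → ⨁ (lookup (flip k x)) ≡ not b
    p k eq = trans (⨁-flip k x) (cong not eq)
    pp : ∀ {b} → ⨁ (lookup x) ≡ b → ⨁ (lookup (flip i (flip j x))) ≡ b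
    pp eq = trans (⨁-flip i (flip j x)) (trans (cong not (p j eq)) (not-involutive _))

    by-parity : ∀ b → ⨁ (lookup x) ≡ b → h x + h (flip i (flip j x)) ≡ h (flip i x) + h (flip j x)
    by-parity false eq = trans (cong₂ _+_ (h-even x eq) (h-even _ (pp eq)))
      (balance (v x) (v (flip i x)) (v (flip j x)) (v (flip i (flip j x)))
        (flips i j i≢j x) (h-odd _ (p i eq)) (h-odd _ (p j eq)))
    -- For odd `x` the other two corners keep their labels, so the roles in `balance` are exchanged.
    by-parity true eq = sym (trans (cong₂ _+_ (h-even _ (p i eq)) (h-even _ (p j eq)))
      (balance (v (flip i x)) (v x) (v (flip i (flip j x))) (v (flip j x))
        (trans (solve 4 (λ a b c d → b :+ a :+ d :+ c := a :+ b :+ c :+ d) refl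
                  (suc (v x)) (suc (v (flip i x))) (suc (v (flip j x))) (suc (v (flip i (flip j x)))))
               (flips i j i≢j x))
        (h-odd _ eq) (h-odd _ (pp eq))))

  e : Fin n → ℕ
  e i = h (flip i zeros)

  linear : ∀ x → h x ≡ ⟪ e , lookup x ⟫
  linear = square⇒linear h square h-zeros

  e-bound : suc (sum e) ≤ N
  -- At the all-true position every linear coefficient contributes to `h`.
  e-bound = subst (_< N)
    (trans (linear (replicate n true))
      (trans (⟪⟫-cong e (λ i → lookup-replicate i true)) (⟪⟫-true e)))
    (Fin.toℕ<n _)

  c : Fin (suc n) → ℕ
  -- The linear part fixes only the weights of the signs (-1)^(|x| + x_i). The weight of (-1)^|x| is
  -- whatever brings the total to 2ⁿ - 1; by `e-bound` the subtraction does not truncate.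
  c zero    = N ∸ suc (sum e)
  c (suc i) = e i

  total : suc (sum c) ≡ N
  total = trans (sym (+-suc (c zero) (sum e))) (m∸n+n≡m e-bound)

  h-sum : ∀ x → ⟪ c , lookup (false ∷ x) ⟫ ≡ h x
  h-sum x = trans (cong (_+ ⟪ e , lookup x ⟫) (*-zeroʳ (c zero))) (sym (linear x))

  spec : ∀ x b → ⨁ (lookup x) ≡ b → v x ≡ ⟪ c , sign x ⟫
  spec x false eq = trans (sym (h-even x eq)) (trans (sym (h-sum x))
    (⟪⟫-cong c (λ k → cong (_xor lookup (false ∷ x) k) (sym eq))))
  -- At odd `x` the sign vector is the complement of `false ∷ x`, matching the reflection that
  -- defines `h`.
  spec x true  eq = +-cancelʳ-≡ (h x) _ _ (trans (suc-injective (trans (h-odd x eq) (sym total)))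
    (sym (trans (cong (⟪ c , sign x ⟫ +_) (sym (h-sum x)))
      (⟪⟫-complement c (sign x) (lookup (false ∷ x)) (λ k → inj₂
        (trans (sym (not-involutive _)) (cong (λ b → not (b xor lookup (false ∷ x) k)) (sym eq))))))))

-- Directions

flip-line : ∀ (j : Fin n) x → IsLine j x (flip j x)
flip-line j x = (λ eq → not-¬ (sym eq) (lookup∘updateAt j x))
              , (λ i i≢j → sym (lookup∘updateAt′ i j i≢j x))

line⇒flip : ∀ (j : Fin n) {x y} → IsLine j x y → y ≡ flip j x
line⇒flip j {x} {y} (≢j , ≡i) = lookup-ext entry
  where
  entry : ∀ i → lookup y i ≡ lookup (flip j x) i
  entry i with i ≟ j
  ... | yes refl = trans (¬-not (≢j ∘ sym)) (sym (lookup∘updateAt i x))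
  ... | no i≢j   = trans (sym (≡i i i≢j)) (sym (lookup∘updateAt′ i j i≢j x))

direction⇒flips : ∀ (B : Labeling n) {j} → HasDirection B j →
  ∀ x → suc (value B x + value B (flip j x)) ≡ 2 ^ n
direction⇒flips B {j} dir x = suc-injective (trans (cong suc (sym (+-suc (value B x) _)))
  (trans (dir x (flip j x) (flip-line j x)) (+-comm _ 1)))

flips⇒direction : ∀ (B : Labeling n) {j} →
  (∀ x → suc (value B x + value B (flip j x)) ≡ 2 ^ n) → HasDirection B j
flips⇒direction B {j} eq x y line rewrite line⇒flip j {x} {y} line =
  trans (cong suc (+-suc (value B x) _)) (trans (cong suc (eq x)) (+-comm 1 _))

-- The neighbours of the origin along `j` and `k` would carry the same complementary label.
direction-unique : ∀ (B : Labeling n) {j k} → HasDirection B j → HasDirection B k → j ≡ k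
direction-unique B {j} {k} dj dk with j ≟ k
... | yes eq = eq
... | no j≢k = contradiction (begin
    lookup zeros j           ≡⟨ lookup∘updateAt′ j k j≢k zeros ⟨
    lookup (flip k zeros) j  ≡⟨ cong (λ x → lookup x j) same ⟨
    lookup (flip j zeros) j  ≡⟨ lookup∘updateAt j zeros ⟩
    not (lookup zeros j)     ∎) (not-¬ refl)
  where
  same : flip j zeros ≡ flip k zeros
  same = value-injective B (+-cancelˡ-≡ (value B zeros) _ _
    (suc-injective (trans (direction⇒flips B dj zeros) (sym (direction⇒flips B dk zeros)))))

sign-zeros : ∀ k → sign (zeros {n}) k ≡ false
sign-zeros {n} zero    = cong (_xor false) (⨁-zeros n)
sign-zeros {n} (suc i) = cong₂ _xor_ (⨁-zeros n) (lookup-zeros i)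

module _ {B : Labeling n} (nf : NormalForm B) where
  open NormalForm nf

  spec′ : ∀ x → value B x ≡ ⟪ coeff , sign (x ⊕ base) ⟫
  spec′ x = trans (cong (value B) (sym (⊕-involutive x base))) (spec (x ⊕ base))

  coeff≡0⇒direction : ∀ {j} → coeff (suc j) ≡ 0 → HasDirection B j
  coeff≡0⇒direction {j} z = flips⇒direction B λ x → trans (cong suc (begin
    value B x + value B (flip j x)
      ≡⟨ cong₂ _+_ (spec′ x) (spec′ (flip j x)) ⟩
    ⟪ coeff , sign (x ⊕ base) ⟫ + ⟪ coeff , sign (flip j x ⊕ base) ⟫
      ≡⟨ cong (λ y → ⟪ coeff , sign (x ⊕ base) ⟫ + ⟪ coeff , sign y ⟫) (flip-⊕ j x base) ⟩
    ⟪ coeff , sign (x ⊕ base) ⟫ + ⟪ coeff , sign (flip j (x ⊕ base)) ⟫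
      ≡⟨ ⟪⟫-complement coeff _ _ (entry (x ⊕ base)) ⟩
    sum coeff ∎)) total
    where
    entry : ∀ y k → coeff k ≡ 0 ⊎ sign (flip j y) k ≡ not (sign y k)
    entry y k with k ≟ suc j
    ... | yes refl = inj₁ z
    ... | no k≢    = inj₂ (sign-flip j k≢ y)

  -- The base has the least value, so its neighbour along `j` has the largest. The sign belonging to
  -- `j` is still false there, so its weight is zero.
  direction⇒coeff≡0 : ∀ {j} → HasDirection B j → coeff (suc j) ≡ 0
  direction⇒coeff≡0 {j} dir = ⟪⟫-maximal coeff (sign (flip j zeros)) maximal (suc j)
    (trans (sign-flip-suc j zeros) (sign-zeros (suc j)))
    where
    base-value : value B (zeros ⊕ base) ≡ 0
    base-value = trans (spec zeros) (trans (⟪⟫-cong coeff sign-zeros) (⟪⟫-false coeff))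

    maximal : ⟪ coeff , sign (flip j zeros) ⟫ ≡ sum coeff
    maximal = suc-injective (begin
      suc ⟪ coeff , sign (flip j zeros) ⟫                                   ≡⟨ cong suc (spec (flip j zeros)) ⟨
      suc (value B (flip j zeros ⊕ base))                                   ≡⟨ cong₂ (λ a y → suc (a + value B y)) (sym base-value) (flip-⊕ j zeros base) ⟩
      suc (value B (zeros ⊕ base) + value B (flip j (zeros ⊕ base)))        ≡⟨ direction⇒flips B dir (zeros ⊕ base) ⟩
      2 ^ n                                                                 ≡⟨ total ⟨
      suc (sum coeff)                                                       ∎)

  maximum : ∃[ x ] ⟪ coeff , sign x ⟫ ≡ sum coeff
  maximum with value-surjective B (≤-reflexive total)
  ... | x , eq = x ⊕ base , trans (sym (spec′ x)) eq

-- Even and odd sign vectors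

-- For even `m`, the member of even parity in the class of `w` modulo constants. `sign x` is `ev` of
-- the representative `false ∷ x`.
ev : (Fin (suc m) → Bool) → Fin (suc m) → Bool
ev w i = ⨁ w xor w i

-- A position stands for a vector modulo constants: the representative whose
-- entry zero is false, with that entry dropped.
point : (Fin (suc m) → Bool) → Position m
point w = tabulate (λ i → w zero xor w (suc i))

xor-cancelˡ : ∀ a b → a xor (a xor b) ≡ b
xor-cancelˡ = solve 2 (λ a b → a :+ (a :+ b) := b) refl
  where open xor-∧-Solver

xor-cancel-common : ∀ a b c → (a xor b) xor (a xor c) ≡ b xor c
xor-cancel-common = solve 3 (λ a b c → (a :+ b) :+ (a :+ c) := b :+ c) refl
  where open xor-∧-Solver

lookup-point : ∀ (w : Fin (suc m) → Bool) i → lookup (false ∷ point w) i ≡ w zero xor w i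
lookup-point w zero    = sym (xor-same (w zero))
lookup-point w (suc i) = lookup∘tabulate _ i

point-shift : ∀ c {u v : Fin (suc m) → Bool} → (∀ i → u i ≡ c xor v i) → point u ≡ point v
point-shift c {u} {v} eq = tabulate-cong λ i →
  trans (cong₂ _xor_ (eq zero) (eq (suc i))) (xor-cancel-common c (v zero) (v (suc i)))

point-lookup : ∀ (x : Position m) → point (lookup (false ∷ x)) ≡ x
point-lookup x = tabulate∘lookup x

point-sign : ∀ (x : Position m) → point (sign x) ≡ x
point-sign x = trans (point-shift (⨁ (lookup x)) {v = lookup (false ∷ x)} (λ i → refl)) (point-lookup x)

module _ (even : Even m) where

  ev-shift : ∀ c {u v : Fin (suc m) → Bool} → (∀ i → u i ≡ c xor v i) → ev u ≗ ev v
  ev-shift c {u} {v} eq i = trans (cong₂ _xor_ (trans (⨁.sum-cong-≗ eq) (⨁-shift even c v)) (eq i))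
    (xor-cancel-common c (⨁ v) (v i))

  ⨁-ev : ∀ (w : Fin (suc m) → Bool) → ⨁ (ev w) ≡ false
  ⨁-ev w = trans (⨁-shift even (⨁ w) w) (xor-same (⨁ w))

  ⨁-sign : ∀ (x : Position m) → ⨁ (sign x) ≡ false
  ⨁-sign x = ⨁-ev (lookup (false ∷ x))

  sign-point : ∀ w → sign (point w) ≗ ev w
  sign-point w = ev-shift (w zero) (lookup-point w)

  even⇒coeff≡0 : {B : Labeling m} (nf : NormalForm B) → ∃[ j ] NormalForm.coeff nf j ≡ 0
  even⇒coeff≡0 nf = i , ⟪⟫-maximal coeff (sign x) eq i ≡false
    where
    open NormalForm nf
    x = proj₁ (maximum nf)
    eq = proj₂ (maximum nf)
    false-entry = ⨁≡false⇒∃false even (sign x) (⨁-sign x)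
    i = proj₁ false-entry
    ≡false = proj₂ false-entry

  -- Here the coordinate signs alone are odd in number and of even parity, so the vanishing weight
  -- is found among theirs and names a direction.
  odd⇒coeff≡0 : {B : Labeling (suc m)} (nf : NormalForm B) → ∃[ j ] NormalForm.coeff nf (suc j) ≡ 0
  odd⇒coeff≡0 nf = i , ⟪⟫-maximal coeff (sign x) eq (suc i) ≡false
    where
    open NormalForm nf
    x = proj₁ (maximum nf)
    eq = proj₂ (maximum nf)
    false-entry = ⨁≡false⇒∃false even (sign x ∘ suc)
      (trans (⨁-shift even (⨁ (lookup x)) (lookup x)) (xor-same (⨁ (lookup x))))
    i = proj₁ false-entry
    ≡false = proj₂ false-entry

ev-of-even : ∀ {w : Fin (suc m) → Bool} → ⨁ w ≡ false → ev w ≗ w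
ev-of-even {w = w} ⨁w i = cong (_xor w i) ⨁w

lookup-removeAt : ∀ (x : Position (suc n)) j k → lookup (removeAt x j) k ≡ lookup x (punchIn j k)
lookup-removeAt x j k = trans (sym (insertAt-punchIn (removeAt x j) j (lookup x j) k))
  (cong (λ y → lookup y (punchIn j k)) (insertAt-removeAt x j))

oddSign : Fin (suc m) → Position (suc m) → Fin (suc m) → Bool
oddSign j x k = sign x (punchIn (suc j) k)

-- Once the sign of direction `j` is dropped, x_j enters only through |x| and shifts the sign vector
-- of the remaining cube by a constant.
oddSign-removeAt : ∀ j (x : Position (suc m)) k →
  oddSign j x k ≡ lookup x j xor sign (removeAt x j) k
oddSign-removeAt j x k = trans (cong₂ _xor_ total (entry k))
  (Bool.xor-assoc (lookup x j) _ _)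
  where
  total : ⨁ (lookup x) ≡ lookup x j xor ⨁ (lookup (removeAt x j))
  total = trans (⨁.sum-remove {i = j} (lookup x))
    (cong (lookup x j xor_) (⨁.sum-cong-≗ (λ k → sym (lookup-removeAt x j k))))

  entry : ∀ k → lookup (false ∷ x) (punchIn (suc j) k) ≡ lookup (false ∷ removeAt x j) k
  entry zero    = refl
  entry (suc k) = sym (lookup-removeAt x j k)

-- Inverse of `oddSign j` for even `m`: the class of `u` gives the remaining coordinates, and its
-- parity gives coordinate `j`.
oddPoint : Fin (suc m) → (Fin (suc m) → Bool) → Position (suc m)
oddPoint j u = insertAt (point u) j (⨁ u)

oddSign-insertAt : ∀ j (y : Position m) b k → oddSign j (insertAt y j b) k ≡ b xor sign y k
oddSign-insertAt j y b k = trans (oddSign-removeAt j (insertAt y j b) k)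
  (cong₂ (λ b y → b xor sign y k) (insertAt-lookup y j b) (removeAt-insertAt y j b))

oddSign-oddPoint : Even m → ∀ j (u : Fin (suc m) → Bool) → oddSign j (oddPoint j u) ≗ u
oddSign-oddPoint even j u k = trans (oddSign-insertAt j (point u) (⨁ u) k)
  (trans (cong (⨁ u xor_) (sign-point even u k)) (xor-cancelˡ (⨁ u) (u k)))

oddPoint-oddSign : Even m → ∀ j (x : Position (suc m)) → oddPoint j (oddSign j x) ≡ x
oddPoint-oddSign even j x = trans (cong₂ (λ y b → insertAt y j b)
    (trans (point-shift (lookup x j) (oddSign-removeAt j x)) (point-sign (removeAt x j)))
    (begin
      ⨁ (oddSign j x)                                       ≡⟨ ⨁.sum-cong-≗ (oddSign-removeAt j x) ⟩
      ⨁ (λ k → lookup x j xor sign (removeAt x j) k)         ≡⟨ ⨁-shift even (lookup x j) (sign (removeAt x j)) ⟩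
      lookup x j xor ⨁ (sign (removeAt x j))                 ≡⟨ cong (lookup x j xor_) (⨁-sign even (removeAt x j)) ⟩
      lookup x j xor false                                   ≡⟨ Bool.xor-identityʳ _ ⟩
      lookup x j                                             ∎))
  (insertAt-removeAt x j)

-- Coefficients of normal forms

-- Surjectivity of `encode` carries the bijectivity of `B` over to subset sums.
encoding⇒exhaustive : ∀ (B : Labeling n) (c : Fin n → ℕ)
  (encode : Position n → Fin n → Bool) (decode : (Fin n → Bool) → Position n) →
  (∀ u → encode (decode u) ≗ u) → (∀ x → value B x ≡ ⟪ c , encode x ⟫) → Exhaustive c
encoding⇒exhaustive {n} B c encode decode inverse spec = record
  { bounded   = λ u → subst (_< 2 ^ n) (sym (sum-value u)) (Fin.toℕ<n (Inverse.to B (decode u)))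
  ; injective = λ u v eq k → begin
      u k                     ≡⟨ inverse u k ⟨
      encode (decode u) k     ≡⟨ cong (λ x → encode x k)
                                   (value-injective B (trans (sym (sum-value u)) (trans eq (sum-value v)))) ⟩
      encode (decode v) k     ≡⟨ inverse v k ⟩
      v k                     ∎
  ; covering  = λ k< → let x , eq = value-surjective B k< in encode x , trans (sym (spec x)) eq
  }
  where
  sum-value : ∀ u → ⟪ c , u ⟫ ≡ value B (decode u)
  sum-value u = trans (⟪⟫-cong c (λ k → sym (inverse u k))) (sym (spec (decode u)))

module _ {B : Labeling n} (nf : NormalForm B) {j} (z : NormalForm.coeff nf j ≡ 0) where
  open NormalForm nf

  reduced-spec : ∀ x → value B x ≡ ⟪ coeff ∘ punchIn j , sign (x ⊕ base) ∘ punchIn j ⟫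
  reduced-spec x = trans (spec′ nf x) (trans (⟪⟫-remove j coeff (sign (x ⊕ base)))
    (cong (λ a → a * bit (sign (x ⊕ base) j) + ⟪ coeff ∘ punchIn j , sign (x ⊕ base) ∘ punchIn j ⟫) z))

  reduced-exhaustive : (decode : (Fin n → Bool) → Position n) →
    (∀ u k → sign (decode u) (punchIn j k) ≡ u k) → Exhaustive (coeff ∘ punchIn j)
  reduced-exhaustive decode inverse = encoding⇒exhaustive B (coeff ∘ punchIn j)
    (λ x → sign (x ⊕ base) ∘ punchIn j) (λ u → decode u ⊕ base)
    (λ u k → trans (cong (λ y → sign y (punchIn j k)) (⊕-involutive (decode u) base)) (inverse u k))
    reduced-spec

fill : Fin (suc n) → (Fin n → Bool) → Fin (suc n) → Bool
fill j u = F.insertAt u j (⨁ u)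

⨁-fill : ∀ j (u : Fin n → Bool) → ⨁ (fill j u) ≡ false
⨁-fill j u = trans (⨁.sum-remove {i = j} (fill j u))
  (trans (cong₂ _xor_ (F.insertAt-lookup u j (⨁ u)) (⨁.sum-cong-≗ (F.insertAt-punchIn u j (⨁ u))))
         (xor-same (⨁ u)))

weights : Fin (suc n) → ℕ
weights zero    = 0
weights (suc k) = powers k

-- The sign at the vanishing weight is determined by even parity and the other n signs are
-- arbitrary, so the remaining weights are exhaustive.
even-coefficients : Even n → ∀ {B : Labeling n} (nf : NormalForm B) →
  ∃[ ρ ] NormalForm.coeff nf ∘ (ρ ⟨$⟩ʳ_) ≗ weights {n}
even-coefficients {n} even nf = Perm.insert zero j ρ , λ where
    zero    → z
    (suc k) → trans (cong coeff (Perm.insert-punchIn zero j ρ k)) (proj₂ permuted k)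
  where
  open NormalForm nf
  j = proj₁ (even⇒coeff≡0 even nf)

  z : coeff j ≡ 0
  z = proj₂ (even⇒coeff≡0 even nf)

  inverse : ∀ u k → sign (point (fill j u)) (punchIn j k) ≡ u k
  inverse u k = trans (sign-point even (fill j u) (punchIn j k))
    (trans (ev-of-even {w = fill j u} (⨁-fill j u) (punchIn j k))
           (F.insertAt-punchIn u j (⨁ u) k))

  permuted : ∃[ ρ ] coeff ∘ punchIn j ∘ (ρ ⟨$⟩ʳ_) ≗ powers {n}
  permuted = exhaustive⇒powers (coeff ∘ punchIn j) (reduced-exhaustive nf z (point ∘ fill j) inverse)

  ρ = proj₁ permuted

odd-coefficients : Even m → ∀ {B : Labeling (suc m)} (nf : NormalForm B) {j} →
  NormalForm.coeff nf (suc j) ≡ 0 →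
  ∃[ ρ ] NormalForm.coeff nf ∘ punchIn (suc j) ∘ (ρ ⟨$⟩ʳ_) ≗ powers {suc m}
odd-coefficients even nf {j} z =
  exhaustive⇒powers (NormalForm.coeff nf ∘ punchIn (suc j)) (reduced-exhaustive nf z (oddPoint j) (λ u → oddSign-oddPoint even j u))

-- Base labelings

-- The head of a position is its least significant digit, in agreement with `powers`.
binary : ∀ n → Position n ↔ Fin (2 ^ n)
binary zero    = mk↔ₛ′ (λ _ → zero) (λ _ → []) (λ { zero → refl }) (λ { [] → refl })
binary (suc n) =
  Perm.cast-id (*-comm (2 ^ n) 2) ↔-∘ (↔-sym Fin.*↔× ↔-∘ mk↔ₛ′ to from to-from from-to)
  where
  digit : Bool → Fin 2
  digit false = zero
  digit true  = suc zero

  to : Position (suc n) → Fin (2 ^ n) × Fin 2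
  to (b ∷ x) = Inverse.to (binary n) x , digit b

  from : Fin (2 ^ n) × Fin 2 → Position (suc n)
  from (k , zero)     = false ∷ Inverse.from (binary n) k
  from (k , suc zero) = true ∷ Inverse.from (binary n) k

  to-from : ∀ p → to (from p) ≡ p
  to-from (k , zero)     = cong (_, zero) (Inverse.strictlyInverseˡ (binary n) k)
  to-from (k , suc zero) = cong (_, suc zero) (Inverse.strictlyInverseˡ (binary n) k)

  from-to : ∀ x → from (to x) ≡ x
  from-to (false ∷ x) = cong (false ∷_) (Inverse.strictlyInverseʳ (binary n) x)
  from-to (true ∷ x)  = cong (true ∷_) (Inverse.strictlyInverseʳ (binary n) x)

binary-value : ∀ n x → value (binary n) x ≡ ⟪ powers , lookup x ⟫
binary-value zero    []      = refl
binary-value (suc n) (b ∷ x) = begin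
  value (binary (suc n)) (b ∷ x)
    ≡⟨ step b ⟩
  2 * value (binary n) x + bit b
    ≡⟨ cong (λ k → 2 * k + bit b) (binary-value n x) ⟩
  2 * ⟪ powers , lookup x ⟫ + bit b
    ≡⟨ +-comm _ (bit b) ⟩
  bit b + 2 * ⟪ powers , lookup x ⟫
    ≡⟨ cong₂ _+_ (sym (+-identityʳ (bit b))) (*-distribˡ-sum 2 (λ k → powers k * bit (lookup x k))) ⟩
  1 * bit b + sum (λ k → 2 * (powers k * bit (lookup x k)))
    ≡⟨ cong (1 * bit b +_) (sum-cong-≗ (λ k → *-assoc 2 (powers k) (bit (lookup x k)))) ⟨
  ⟪ powers , lookup (b ∷ x) ⟫ ∎
  where
  step : ∀ b → value (binary (suc n)) (b ∷ x) ≡ 2 * value (binary n) x + bit b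
  step false = trans (Fin.toℕ-cast _ _) (Fin.toℕ-combine (Inverse.to (binary n) x) (zero {1}))
  step true  = trans (Fin.toℕ-cast _ _) (Fin.toℕ-combine (Inverse.to (binary n) x) (suc (zero {0})))

sum-powers : ∀ n → suc (sum (powers {n})) ≡ 2 ^ n
sum-powers zero    = refl
sum-powers (suc n) = begin
  2 + sum (λ k → 2 * powers {n} k)  ≡⟨ cong (2 +_) (*-distribˡ-sum 2 (powers {n})) ⟨
  2 + 2 * sum (powers {n})          ≡⟨ *-suc 2 (sum (powers {n})) ⟨
  2 * suc (sum (powers {n}))        ≡⟨ cong (2 *_) (sum-powers n) ⟩
  2 ^ suc n                         ∎

module _ (even : Even m) where

  -- `reflect` complements the positions of odd parity. In even dimension this preserves parity,
  -- hence is an involution.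
  evenLabeling : Labeling m
  evenLabeling = binary m ↔-∘ mk↔ₛ′ reflect reflect involutive involutive
    where
    reflect : Position m → Position m
    reflect x = tabulate (sign x ∘ suc)

    ⨁-reflect : ∀ x → ⨁ (lookup (reflect x)) ≡ ⨁ (lookup x)
    ⨁-reflect x = trans (⨁.sum-cong-≗ (lookup∘tabulate (sign x ∘ suc)))
      (trans (⨁.∑-distrib-+ (λ _ → ⨁ (lookup x)) (lookup x)) (cong (_xor ⨁ (lookup x)) (even _)))

    involutive : ∀ x → reflect (reflect x) ≡ x
    involutive x = trans (tabulate-cong (λ i → trans
        (cong₂ _xor_ (⨁-reflect x) (lookup∘tabulate (sign x ∘ suc) i))
        (xor-cancelˡ (⨁ (lookup x)) (lookup x i))))
      (tabulate∘lookup x)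

  evenLabeling-value : ∀ x → value evenLabeling x ≡ ⟪ weights , sign x ⟫
  evenLabeling-value x = trans (binary-value m _) (⟪⟫-cong powers (lookup∘tabulate (sign x ∘ suc)))

  oddLabeling : Fin (suc m) → Labeling (suc m)
  oddLabeling j = binary (suc m) ↔-∘ mk↔ₛ′
    (λ x → tabulate (oddSign j x))
    (λ u → oddPoint j (lookup u))
    (λ u → trans (tabulate-cong (oddSign-oddPoint even j (lookup u))) (tabulate∘lookup u))
    (λ x → trans
      (cong₂ (λ y b → insertAt y j b) (point-shift false (lookup∘tabulate (oddSign j x)))
        (⨁.sum-cong-≗ (lookup∘tabulate (oddSign j x))))
      (oddPoint-oddSign even j x))

  oddLabeling-value : ∀ j x → value (oddLabeling j) x ≡ ⟪ powers , oddSign j x ⟫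
  oddLabeling-value j x = trans (binary-value (suc m) _) (⟪⟫-cong powers (lookup∘tabulate (oddSign j x)))

-- Faithful actions

record FaithfulAction (H : Group 0ℓ 0ℓ) (X : Set) : Set where
  open Group H using (Carrier; _≈_; _∙_; ε; _⁻¹; inverseˡ; inverseʳ)
  field
    act      : Carrier → X → X
    act-cong : ∀ {g h} → g ≈ h → ∀ x → act g x ≡ act h x
    act-∙    : ∀ g h x → act (g ∙ h) x ≡ act g (act h x)
    act-ε    : ∀ x → act ε x ≡ x
    faithful : ∀ {g h} → (∀ x → act g x ≡ act h x) → g ≈ h

  act-inverseˡ : ∀ h x → act (h ⁻¹) (act h x) ≡ x
  act-inverseˡ h x = trans (sym (act-∙ (h ⁻¹) h x)) (trans (act-cong (inverseˡ h) x) (act-ε x))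

  act-inverseʳ : ∀ h x → act h (act (h ⁻¹) x) ≡ x
  act-inverseʳ h x = trans (sym (act-∙ h (h ⁻¹) x)) (trans (act-cong (inverseʳ h) x) (act-ε x))

  permutation : Carrier → X ↔ X
  permutation h = mk↔ₛ′ (act h) (act (h ⁻¹)) (act-inverseʳ h) (act-inverseˡ h)

  image : Subgroup (Sym X)
  image = record
    { Member    = λ f → ∃[ h ] (∀ x → Inverse.to f x ≡ act h x)
    ; resp      = λ f≈g (h , eq) → h , λ x → trans (sym (f≈g x)) (eq x)
    ; ∙-closed  = λ {_} {g} (h , eq) (k , eq′) → h ∙ k , λ x →
        trans (eq (Inverse.to g x)) (trans (cong (act h) (eq′ x)) (sym (act-∙ h k x)))
    ; ε-closed  = ε , λ x → sym (act-ε x)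
    ; ⁻¹-closed = λ {f} (h , eq) → h ⁻¹ , λ x → begin
        Inverse.from f x                              ≡⟨ act-inverseˡ h _ ⟨
        act (h ⁻¹) (act h (Inverse.from f x))         ≡⟨ cong (act (h ⁻¹)) (eq _) ⟨
        act (h ⁻¹) (Inverse.to f (Inverse.from f x))  ≡⟨ cong (act (h ⁻¹)) (Inverse.strictlyInverseˡ f x) ⟩
        act (h ⁻¹) x                                  ∎
    }

  -- Faithfulness determines the group element stored with a member, so projecting to it is well
  -- defined.
  image≅ : Subgroup.group image ≅ H
  image≅ = (λ (_ , h , _) → h) , record
    { isGroupMonomorphism = record
      { isGroupHomomorphism = record
        { isMonoidHomomorphism = record
          { isMagmaHomomorphism = record
            { isRelHomomorphism = record
              { cong = λ {(_ , _ , eq)} {(_ , _ , eq′)} f≈g →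
                  faithful (λ x → trans (sym (eq x)) (trans (f≈g x) (eq′ x))) }
            ; homo = λ _ _ → Group.refl H
            }
          ; ε-homo = Group.refl H
          }
        ; ⁻¹-homo = λ _ → Group.refl H
        }
      ; injective = λ {(_ , _ , eq)} {(_ , _ , eq′)} g≈h x →
          trans (eq x) (trans (act-cong g≈h x) (sym (eq′ x)))
      }
    ; surjective = λ h → (permutation h , h , λ _ → refl) ,
        λ {(_ , _ , eq)} f≈ → faithful (λ x → trans (sym (eq x)) (f≈ x))
    }

module _ {H : Group 0ℓ 0ℓ} (𝓐 : FaithfulAction H (Position n)) where
  open Group H using (Carrier; _≈_; _∙_; ε; _⁻¹; inverseˡ; inverseʳ)
  open FaithfulAction 𝓐

  -- This says B = h⁻¹ • A; composing with `act h` directly suits the formulas for values and gives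
  -- the same orbits.
  Transports : Labeling n → Labeling n → Carrier → Set
  Transports A B h = ∀ x → Inverse.to B x ≡ Inverse.to A (act h x)

  IsOrbitOf : Labeling n → Pred (Labeling n) 0ℓ → Set
  IsOrbitOf A M = ∀ B → M B ⇔ ∃ (Transports A B)

  singleOrbit : ∀ A {M} → IsOrbitOf A M → IsSingleOrbit image M
  singleOrbit A {M} orbit = A , λ B → mk⇔
    (λ MB → let h , eq = Equivalence.to (orbit B) MB in
      ↔-sym (permutation h) , (h ⁻¹ , λ _ → refl) , λ x → sym (eq x))
    (λ (g , g∈ , eq) → let h , eq′ = Subgroup.⁻¹-closed image {g} g∈ in
      Equivalence.from (orbit B) (h , λ x → trans (sym (eq x)) (cong (Inverse.to A) (eq′ x))))

  -- A labeling is a bijection, so a faithful action on positions is free on labelings. Orbits are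
  -- therefore counted by the group.
  transports-injective : ∀ A {B C g h} → Transports A B g → Transports A C h → B ≋ C → g ≈ h
  transports-injective A {B} {C} {g} {h} tB tC B≋C = faithful λ x → begin
    act g x                                            ≡⟨ Inverse.strictlyInverseʳ A _ ⟨
    Inverse.from A (Inverse.to A (act g x))            ≡⟨ cong (Inverse.from A) (trans (sym (tB x)) (trans (B≋C x) (tC x))) ⟩
    Inverse.from A (Inverse.to A (act h x))            ≡⟨ Inverse.strictlyInverseʳ A _ ⟩
    act h x                                            ∎

  transports-cong : ∀ A {B C g h} → Transports A B g → Transports A C h → g ≈ h → B ≋ C
  transports-cong A {B} {C} tB tC g≈h x =
    trans (tB x) (trans (cong (Inverse.to A) (act-cong g≈h x)) (sym (tC x)))

-- Signed permutations

module _ (m : ℕ) where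
  private
    module G = Group (C₂^ m ⋊S₁₊)

  -- The affine map x ↦ v + σx on F₂^(m+1) modulo constants, computed on the representative
  -- `false ∷ x` and renormalised by `point`.
  actₛ : G.Carrier → Position m → Position m
  actₛ (v , σ) x = point (λ i → v i xor lookup (false ∷ x) (Inverse.from σ i))

  lookup-actₛ : ∀ h x i → lookup (false ∷ actₛ h x) i ≡
    (proj₁ h zero xor lookup (false ∷ x) (Inverse.from (proj₂ h) zero)) xor
    (proj₁ h i xor lookup (false ∷ x) (Inverse.from (proj₂ h) i))
  lookup-actₛ (v , σ) x i = lookup-point (λ i → v i xor lookup (false ∷ x) (Inverse.from σ i)) i

  actₛ-cong : ∀ {g h} → g G.≈ h → ∀ x → actₛ g x ≡ actₛ h x
  actₛ-cong {u , σ} {v , τ} ((c , eq) , σ≈τ) x = point-shift c λ i → trans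
    (cong₂ _xor_ (eq i) (cong (lookup (false ∷ x)) (Group.⁻¹-cong (Sym (Fin (suc m))) {σ} {τ} σ≈τ i)))
    (Bool.xor-assoc c (v i) _)

  actₛ-∙ : ∀ g h x → actₛ (g G.∙ h) x ≡ actₛ g (actₛ h x)
  actₛ-∙ (u , σ) (v , τ) x = point-shift c λ i → trans
    (swap (u i) (v (Inverse.from σ i)) c _)
    (cong (λ b → c xor (u i xor b)) (sym (lookup-actₛ (v , τ) x (Inverse.from σ i))))
    where
    -- The constant removed when the inner action is renormalised.
    c = v zero xor lookup (false ∷ x) (Inverse.from τ zero)
    swap : ∀ a b c d → (a xor b) xor d ≡ c xor (a xor (c xor (b xor d)))
    swap = solve 4 (λ a b c d → (a :+ b) :+ d := c :+ (a :+ (c :+ (b :+ d)))) refl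
      where open xor-∧-Solver

  module _ (even : Even m) where

    -- Permuting preserves parity and adding `v` adds its parity, so on even representatives the
    -- action is a plain signed permutation.
    sign-actₛ : ∀ (v : Fin (suc m) → Bool) σ x k → sign (actₛ (v , σ) x) k ≡ ev v k xor sign x (Inverse.from σ k)
    sign-actₛ v σ x k = trans (sign-point even w k) (trans
      (cong (_xor w k) (trans (⨁.∑-distrib-+ v (lookup (false ∷ x) ∘ Inverse.from σ))
        (cong (⨁ v xor_) (sym (⨁.sum-permute (lookup (false ∷ x)) (↔-sym σ))))))
      (interchange (⨁ v) (⨁ (lookup x)) (v k) (lookup (false ∷ x) (Inverse.from σ k))))
      where
      w : Fin (suc m) → Bool
      w i = v i xor lookup (false ∷ x) (Inverse.from σ i)
      interchange : ∀ a b c d → (a xor b) xor (c xor d) ≡ (a xor c) xor (b xor d)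
      interchange = solve 4 (λ a b c d → (a :+ b) :+ (c :+ d) := (a :+ c) :+ (b :+ d)) refl
        where open xor-∧-Solver

    signs-separate : ∀ {k l : Fin (suc m)} → (∀ x → sign x k ≡ sign x l) → k ≡ l
    signs-separate {k} {l} eq with k ≟ l
    ... | yes k≡l = k≡l
    ... | no  k≢l = case trans (sym (at k (dec-true (k ≟ k) refl))) (trans (cong (⨁ w xor_) equal) (at l (dec-false (k ≟ l) k≢l))) of λ ()
      where
      w : Fin (suc m) → Bool
      -- The indicator of `k` separates `k` from `l`, and its even member differs from it only by a
      -- constant.
      w i = does (k ≟ i)
      at : ∀ i {b} → w i ≡ b → ⨁ w xor (ev w i) ≡ b
      at i eq = trans (xor-cancelˡ (⨁ w) (w i)) eq
      equal : ev w k ≡ ev w l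
      equal = trans (sym (sign-point even w k)) (trans (eq (point w)) (sign-point even w l))

    -- All signs are false at the origin, so evaluation there determines the translation modulo
    -- constants. The permutation follows because distinct indices give distinct signs.
    actₛ-faithful : ∀ {g h} → (∀ x → actₛ g x ≡ actₛ h x) → g G.≈ h
    actₛ-faithful {u , σ} {v , τ} eq = (⨁ u xor ⨁ v , u≈v) , σ≈τ
      where
      sign-eq : ∀ x k → ev u k xor sign x (Inverse.from σ k) ≡ ev v k xor sign x (Inverse.from τ k)
      sign-eq x k = trans (sym (sign-actₛ u σ x k)) (trans (cong (λ y → sign y k) (eq x)) (sign-actₛ v τ x k))

      ev-eq : ∀ k → ev u k ≡ ev v k
      ev-eq k = begin
        ev u k                                          ≡⟨ Bool.xor-identityʳ _ ⟨
        ev u k xor false                                ≡⟨ cong (ev u k xor_) (sign-zeros (Inverse.from σ k)) ⟨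
        ev u k xor sign zeros (Inverse.from σ k)        ≡⟨ sign-eq zeros k ⟩
        ev v k xor sign zeros (Inverse.from τ k)        ≡⟨ cong (ev v k xor_) (sign-zeros (Inverse.from τ k)) ⟩
        ev v k xor false                                ≡⟨ Bool.xor-identityʳ _ ⟩
        ev v k                                          ∎

      u≈v : ∀ k → u k ≡ (⨁ u xor ⨁ v) xor v k
      u≈v k = trans (sym (xor-cancelˡ (⨁ u) (u k)))
        (trans (cong (⨁ u xor_) (ev-eq k)) (sym (Bool.xor-assoc (⨁ u) (⨁ v) (v k))))

      from-eq : ∀ k → Inverse.from σ k ≡ Inverse.from τ k
      from-eq k = signs-separate λ x → begin
        sign x (Inverse.from σ k)                                   ≡⟨ xor-cancelˡ (ev u k) _ ⟨
        ev u k xor (ev u k xor sign x (Inverse.from σ k))           ≡⟨ cong₂ _xor_ (ev-eq k) (sign-eq x k) ⟩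
        ev v k xor (ev v k xor sign x (Inverse.from τ k))           ≡⟨ xor-cancelˡ (ev v k) _ ⟩
        sign x (Inverse.from τ k)                                   ∎

      σ≈τ : ∀ i → Inverse.to σ i ≡ Inverse.to τ i
      σ≈τ = Group.⁻¹-cong (Sym (Fin (suc m))) {↔-sym σ} {↔-sym τ} from-eq

    evenAction : FaithfulAction (C₂^ m ⋊S₁₊) (Position m)
    evenAction = record
      { act      = actₛ
      ; act-cong = λ {g} {h} → actₛ-cong {g} {h}
      ; act-∙    = actₛ-∙
      ; act-ε    = point-lookup
      ; faithful = λ {g} {h} → actₛ-faithful {g} {h}
      }

    -- The first factor acts on the cube without coordinate `j`, and C₂ flips that coordinate.
    oddAct : Fin (suc m) → Group.Carrier ((C₂^ m ⋊S₁₊) ×ᴳ C₂) → Position (suc m) → Position (suc m)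
    oddAct j (h , b) x = insertAt (actₛ h (removeAt x j)) j (b xor lookup x j)

    insertAt-injective : ∀ j {y z : Position m} {a b} → insertAt y j a ≡ insertAt z j b → y ≡ z × a ≡ b
    insertAt-injective j {y} {z} {a} {b} eq =
      trans (sym (removeAt-insertAt y j a)) (trans (cong (λ x → removeAt x j) eq) (removeAt-insertAt z j b)) ,
      trans (sym (insertAt-lookup y j a)) (trans (cong (λ x → lookup x j) eq) (insertAt-lookup z j b))

    oddAction : Fin (suc m) → FaithfulAction ((C₂^ m ⋊S₁₊) ×ᴳ C₂) (Position (suc m))
    oddAction j = record
      { act      = oddAct j
      ; act-cong = λ {(g , a)} {(h , b)} (g≈h , a≡b) x → cong₂ (λ y c → insertAt y j (c xor lookup x j))
          (actₛ-cong {g} {h} g≈h (removeAt x j)) a≡b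
      ; act-∙    = λ (g , a) (h , b) x → cong₂ (λ y c → insertAt y j c)
          (trans (actₛ-∙ g h (removeAt x j))
                 (cong (actₛ g) (sym (removeAt-insertAt (actₛ h (removeAt x j)) j (b xor lookup x j)))))
          (trans (Bool.xor-assoc a b (lookup x j))
                 (cong (a xor_) (sym (insertAt-lookup (actₛ h (removeAt x j)) j (b xor lookup x j)))))
      ; act-ε    = λ x → trans (cong (λ y → insertAt y j (lookup x j)) (point-lookup (removeAt x j)))
          (insertAt-removeAt x j)
      ; faithful = λ {(g , a)} {(h , b)} eq →
            actₛ-faithful {g} {h} (λ y → trans
              (cong (actₛ g) (sym (removeAt-insertAt y j false)))
              (trans (proj₁ (insertAt-injective j (eq (insertAt y j false))))
                     (cong (actₛ h) (removeAt-insertAt y j false))))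
          , (begin
              a                                                       ≡⟨ xor-cancelʳ a (lookup zeros j) ⟨
              (a xor lookup zeros j) xor lookup zeros j               ≡⟨ cong (_xor lookup zeros j) (proj₂ (insertAt-injective j (eq zeros))) ⟩
              (b xor lookup zeros j) xor lookup zeros j               ≡⟨ xor-cancelʳ b (lookup zeros j) ⟩
              b                                                       ∎)
      }
      where
      xor-cancelʳ : ∀ a b → (a xor b) xor b ≡ a
      xor-cancelʳ = solve 2 (λ a b → (a :+ b) :+ b := a) refl
        where open xor-∧-Solver

    -- Orbits

    evenOrbit : IsOrbitOf evenAction (evenLabeling even) MagicFaced
    evenOrbit B = mk⇔ (transport ∘ magic⇒normalForm B) λ ((v , σ) , eq) →
      signed⇒magic B weights (ev v) (Inverse.from σ) λ x →
        trans (cong toℕ (eq x)) (trans (evenLabeling-value even (actₛ (v , σ) x))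
          (⟪⟫-cong weights (sign-actₛ v σ x)))
      where
      transport : NormalForm B → ∃ (Transports evenAction (evenLabeling even) B)
      transport nf = (v , ↔-sym ρ) , λ x → Fin.toℕ-injective (begin
        value B x                                                    ≡⟨ spec′ nf x ⟩
        ⟪ coeff , sign (x ⊕ base) ⟫                                  ≡⟨ ⟪⟫-permute ρ coeff (sign (x ⊕ base)) ⟩
        ⟪ coeff ∘ (ρ ⟨$⟩ʳ_) , sign (x ⊕ base) ∘ (ρ ⟨$⟩ʳ_) ⟫          ≡⟨ ⟪⟫-congˡ (proj₂ permuted) (sign (x ⊕ base) ∘ (ρ ⟨$⟩ʳ_)) ⟩
        ⟪ weights , sign (x ⊕ base) ∘ (ρ ⟨$⟩ʳ_) ⟫                    ≡⟨ ⟪⟫-cong weights (entry x) ⟩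
        ⟪ weights , sign (actₛ (v , ↔-sym ρ) x) ⟫                    ≡⟨ evenLabeling-value even (actₛ (v , ↔-sym ρ) x) ⟨
        value (evenLabeling even) (actₛ (v , ↔-sym ρ) x)             ∎)
        where
        open NormalForm nf
        permuted = even-coefficients even nf
        ρ = proj₁ permuted
        -- The signs of the position labelled 1, in the order that sorts the weights. The action
        -- reads permutations through their inverse, whence `↔-sym ρ`.
        v = sign base ∘ (ρ ⟨$⟩ʳ_)

        ⨁v : ⨁ v ≡ false
        ⨁v = trans (sym (⨁.sum-permute (sign base) ρ)) (⨁-sign even base)

        entry : ∀ x k → sign (x ⊕ base) (ρ ⟨$⟩ʳ k) ≡ sign (actₛ (v , ↔-sym ρ) x) k
        entry x k = trans (sign-⊕ x base (ρ ⟨$⟩ʳ k)) (trans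
          (cong (_xor sign x (ρ ⟨$⟩ʳ k)) (sym (ev-of-even {w = v} ⨁v k)))
          (sym (sign-actₛ v (↔-sym ρ) x k)))

    oddSign-act : ∀ j v σ b x k → oddSign j (oddAct j ((v , σ) , b) x) k ≡
                  (b xor ev v k) xor oddSign j x (Inverse.from σ k)
    oddSign-act j v σ b x k = begin
      oddSign j (oddAct j ((v , σ) , b) x) k
        ≡⟨ oddSign-insertAt j (actₛ (v , σ) (removeAt x j)) (b xor lookup x j) k ⟩
      (b xor lookup x j) xor sign (actₛ (v , σ) (removeAt x j)) k
        ≡⟨ cong ((b xor lookup x j) xor_) (sign-actₛ v σ (removeAt x j) k) ⟩
      (b xor lookup x j) xor (ev v k xor sign (removeAt x j) (Inverse.from σ k))
        ≡⟨ solve 4 (λ a b c d → (a :+ b) :+ (c :+ d) := (a :+ c) :+ (b :+ d)) refl b (lookup x j) (ev v k) (sign (removeAt x j) (Inverse.from σ k)) ⟩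
      (b xor ev v k) xor (lookup x j xor sign (removeAt x j) (Inverse.from σ k))
        ≡⟨ cong ((b xor ev v k) xor_) (oddSign-removeAt j x (Inverse.from σ k)) ⟨
      (b xor ev v k) xor oddSign j x (Inverse.from σ k) ∎
      where open xor-∧-Solver

    oddOrbit : ∀ j → IsOrbitOf (oddAction j) (oddLabeling even j) (λ B → MagicFaced B × HasDirection B j)
    oddOrbit j B = mk⇔ (λ (magic , dir) → transport (magic⇒normalForm B magic) dir) λ (((v , σ) , b) , eq) →
      let a : Fin (suc m) → Bool
          a k = b xor ev v k
          s : Fin (suc m) → Fin (suc (suc m))
          s k = punchIn (suc j) (Inverse.from σ k)
          spec : ∀ x → value B x ≡ ⟪ powers , (λ k → a k xor sign x (s k)) ⟫
          spec x = trans (cong toℕ (eq x)) (trans (oddLabeling-value even j (oddAct j ((v , σ) , b) x))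
            (⟪⟫-cong powers (oddSign-act j v σ b x)))
      in signed⇒magic B powers a s spec ,
         -- `punchIn (suc j)` avoids the sign of direction `j`, so flipping coordinate `j`
         -- complements every bit.
         flips⇒direction B (λ x → trans (cong suc (trans (cong₂ _+_ (spec x) (spec (flip j x)))
           (⟪⟫-complement powers (λ k → a k xor sign x (s k)) (λ k → a k xor sign (flip j x) (s k)) (λ k → inj₂ (trans
             (cong (a k xor_) (sign-flip j (Fin.punchInᵢ≢i (suc j) (Inverse.from σ k)) x))
             (xor-not (a k) (sign x (s k))))))))
           (sum-powers (suc m)))
      where
      transport : NormalForm B → HasDirection B j → ∃ (Transports (oddAction j) (oddLabeling even j) B)
      transport nf dir = h , λ x → Fin.toℕ-injective (begin
        value B x                                                          ≡⟨ reduced-spec nf {suc j} z x ⟩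
        ⟪ c , sign (x ⊕ base) ∘ punchIn (suc j) ⟫                          ≡⟨ ⟪⟫-permute ρ c (sign (x ⊕ base) ∘ punchIn (suc j)) ⟩
        ⟪ c ∘ (ρ ⟨$⟩ʳ_) , oddSign j (x ⊕ base) ∘ (ρ ⟨$⟩ʳ_) ⟫               ≡⟨ ⟪⟫-congˡ (proj₂ permuted) (oddSign j (x ⊕ base) ∘ (ρ ⟨$⟩ʳ_)) ⟩
        ⟪ powers , oddSign j (x ⊕ base) ∘ (ρ ⟨$⟩ʳ_) ⟫                      ≡⟨ ⟪⟫-cong powers (entry x) ⟩
        ⟪ powers , oddSign j (oddAct j h x) ⟫                              ≡⟨ oddLabeling-value even j (oddAct j h x) ⟨
        value (oddLabeling even j) (oddAct j h x)                          ∎)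
        where
        open NormalForm nf
        z : coeff (suc j) ≡ 0
        z = direction⇒coeff≡0 nf dir
        c = coeff ∘ punchIn (suc j)
        permuted = odd-coefficients even nf {j} z
        ρ = proj₁ permuted
        v = oddSign j base ∘ (ρ ⟨$⟩ʳ_)
        h : Group.Carrier ((C₂^ m ⋊S₁₊) ×ᴳ C₂)
        -- Here `v` may have odd parity. The first factor only realises `ev v`, and the C₂ component
        -- restores the missing constant `⨁ v`.
        h = (v , ↔-sym ρ) , ⨁ v

        entry : ∀ x k → oddSign j (x ⊕ base) (ρ ⟨$⟩ʳ k) ≡ oddSign j (oddAct j h x) k
        entry x k = trans (sign-⊕ x base (punchIn (suc j) (ρ ⟨$⟩ʳ k))) (trans
          (cong (_xor oddSign j x (ρ ⟨$⟩ʳ k)) (sym (xor-cancelˡ (⨁ v) (v k))))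
          (sym (oddSign-act j v (↔-sym ρ) (⨁ v) x k)))

-- Cardinalities

module _ (S T : Setoid 0ℓ 0ℓ) where
  private
    module S = Setoid S
    module T = Setoid T

  cardinality-via : ∀ {k} (f : S.Carrier → T.Carrier) (g : T.Carrier → S.Carrier) →
    (∀ {x y} → x S.≈ y → f x T.≈ f y) → (∀ {x y} → x T.≈ y → g x S.≈ g y) →
    (∀ y → f (g y) T.≈ y) → (∀ x → g (f x) S.≈ x) →
    HasCardinality T k → HasCardinality S k
  cardinality-via f g f-cong g-cong f-g g-f = Compose.inverse record
    { to        = f
    ; from      = g
    ; to-cong   = f-cong
    ; from-cong = g-cong
    ; inverse   = (λ {x} eq → T.trans (f-cong eq) (f-g x)) , (λ {x} eq → S.trans (g-cong eq) (g-f x))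
    }

  ×-cardinality : ∀ {a b} → HasCardinality S a → HasCardinality T b →
                  HasCardinality (×-setoid S T) (a * b)
  ×-cardinality {a} {b} α β = record
    { to        = λ (x , y) → Fin.combine (A.to x) (B.to y)
    ; from      = λ k → A.from (proj₁ (Fin.remQuot {a} b k)) , B.from (proj₂ (Fin.remQuot {a} b k))
    ; to-cong   = λ (p , q) → cong₂ Fin.combine (A.to-cong p) (B.to-cong q)
    ; from-cong = λ { refl → S.refl , T.refl }
    ; inverse   = (λ {k} (p , q) → trans (cong₂ Fin.combine (A.inverseˡ p) (B.inverseˡ q)) (Fin.combine-remQuot {a} b k))
                , (λ {(x , y)} eq → A.inverseʳ (trans (cong (λ k → proj₁ (Fin.remQuot {a} b k)) eq) (cong proj₁ (Fin.remQuot-combine (A.to x) (B.to y))))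
                                  , B.inverseʳ (trans (cong (λ k → proj₂ (Fin.remQuot {a} b k)) eq) (cong proj₂ (Fin.remQuot-combine (A.to x) (B.to y)))))
    }
    where
    module A = Inverse α
    module B = Inverse β

Fin-cardinality : ∀ n → HasCardinality (setoid (Fin n)) n
Fin-cardinality n = Identity.inverse (setoid (Fin n))

remove₀-cong : ∀ (π ρ : Permutation (suc n) (suc n)) → (∀ i → π ⟨$⟩ʳ i ≡ ρ ⟨$⟩ʳ i) →
  ∀ i → Perm.remove zero π ⟨$⟩ʳ i ≡ Perm.remove zero ρ ⟨$⟩ʳ i
remove₀-cong π ρ eq i = Fin.punchIn-injective (π ⟨$⟩ʳ zero) _ _ (begin
  punchIn (π ⟨$⟩ʳ zero) (Perm.remove zero π ⟨$⟩ʳ i)  ≡⟨ Perm.punchIn-permute π zero i ⟨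
  π ⟨$⟩ʳ suc i                                       ≡⟨ eq (suc i) ⟩
  ρ ⟨$⟩ʳ suc i                                       ≡⟨ Perm.punchIn-permute ρ zero i ⟩
  punchIn (ρ ⟨$⟩ʳ zero) (Perm.remove zero ρ ⟨$⟩ʳ i)  ≡⟨ cong (λ j → punchIn j (Perm.remove zero ρ ⟨$⟩ʳ i)) (eq zero) ⟨
  punchIn (π ⟨$⟩ʳ zero) (Perm.remove zero ρ ⟨$⟩ʳ i)  ∎)

insert₀-cong : ∀ {i j : Fin (suc n)} (π ρ : Permutation n n) → i ≡ j → (∀ k → π ⟨$⟩ʳ k ≡ ρ ⟨$⟩ʳ k) →
  ∀ k → Perm.insert zero i π ⟨$⟩ʳ k ≡ Perm.insert zero j ρ ⟨$⟩ʳ k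
insert₀-cong π ρ refl eq zero = refl
insert₀-cong {i = i} π ρ refl eq (suc k) = trans (Perm.insert-punchIn zero i π k)
  (trans (cong (punchIn i) (eq k)) (sym (Perm.insert-punchIn zero i ρ k)))

Sym-cardinality : ∀ n → HasCardinality (Group.setoid (Sym (Fin n))) (n !)
Sym-cardinality zero    = record
  { to        = λ _ → zero
  ; from      = λ _ → Perm.id
  ; to-cong   = λ _ → refl
  ; from-cong = λ _ ()
  ; inverse   = (λ { {zero} _ → refl }) , (λ _ ())
  }
Sym-cardinality (suc n) = cardinality-via (Group.setoid (Sym (Fin (suc n))))
  (×-setoid (setoid (Fin (suc n))) (Group.setoid (Sym (Fin n))))
  (λ π → π ⟨$⟩ʳ zero , Perm.remove zero π)
  (λ (i , π) → Perm.insert zero i π)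
  (λ {π} {ρ} eq → eq zero , remove₀-cong π ρ eq)
  (λ {(i , π)} {(j , ρ)} (p , q) → insert₀-cong π ρ p q)
  (λ (i , π) → refl , Perm.remove-insert zero i π)
  (λ π → Perm.insert-remove zero π)
  (×-cardinality _ _ (Fin-cardinality (suc n)) (Sym-cardinality n))

C₂^-cardinality : ∀ m → HasCardinality (Group.setoid (C₂^ m)) (2 ^ m)
C₂^-cardinality m = cardinality-via (Group.setoid (C₂^ m)) (setoid (Position m))
  point (λ x → lookup (false ∷ x))
  (λ (c , eq) → point-shift c eq)
  (λ { refl → false , λ _ → refl })
  point-lookup
  (λ w → w zero , lookup-point w)
  (binary m)

C₂-cardinality : HasCardinality (Group.setoid C₂) 2
C₂-cardinality = ↔-sym Fin.2↔Bool

⋊-cardinality : ∀ m → HasCardinality (Group.setoid (C₂^ m ⋊S₁₊)) (2 ^ m * suc m !)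
⋊-cardinality m = ×-cardinality (Group.setoid (C₂^ m)) (Group.setoid (Sym (Fin (suc m))))
  (C₂^-cardinality m) (Sym-cardinality (suc m))

satisfying : Pred (Labeling n) 0ℓ → Setoid 0ℓ 0ℓ
satisfying M = record
  { Carrier       = ∃ M
  ; _≈_           = λ (B , _) (C , _) → B ≋ C
  ; isEquivalence = record
    { refl  = λ x → refl
    ; sym   = λ p x → sym (p x)
    ; trans = λ p q x → trans (p x) (q x)
    }
  }

module _ {H : Group 0ℓ 0ℓ} where
  private
    module H = Group H

  moved : FaithfulAction H (Position n) → Labeling n → H.Carrier → Labeling n
  moved 𝓐 A h = A ↔-∘ FaithfulAction.permutation 𝓐 h

  orbit-cardinality : ∀ (𝓐 : FaithfulAction H (Position n)) A {M k} → IsOrbitOf 𝓐 A M →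
    HasCardinality (Group.setoid H) k → HasCardinality (satisfying M) k
  orbit-cardinality 𝓐 A {M} orbit = cardinality-via (satisfying M) (Group.setoid H)
    (λ (B , MB) → proj₁ (transport B MB))
    (λ h → moved 𝓐 A h , Equivalence.from (orbit (moved 𝓐 A h)) (h , λ _ → refl))
    (λ {(B , MB)} {(C , MC)} → transports-injective 𝓐 A {B} {C} (proj₂ (transport B MB)) (proj₂ (transport C MC)))
    (λ {g} {h} → transports-cong 𝓐 A {moved 𝓐 A g} {moved 𝓐 A h} {g} {h} (λ _ → refl) (λ _ → refl))
    (λ h → transports-injective 𝓐 A {moved 𝓐 A h} {moved 𝓐 A h} (proj₂ (transport (moved 𝓐 A h) _)) (λ _ → refl) (λ _ → refl))
    (λ (B , MB) x → sym (proj₂ (transport B MB) x))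
    where
    transport : ∀ B → M B → ∃ (Transports 𝓐 A B)
    transport B = Equivalence.to (orbit B)

  -- Different indices give disjoint free orbits, so a labeling is coded by its index and a group
  -- element.
  orbits-cardinality : ∀ {j k} (𝓐 : Fin j → FaithfulAction H (Position n)) (A : Fin j → Labeling n)
    {M : Pred (Labeling n) 0ℓ} {D : Labeling n → Fin j → Set} →
    (∀ i → IsOrbitOf (𝓐 i) (A i) (λ B → M B × D B i)) →
    (∀ B → M B → ∃ (D B)) → (∀ {B C i l} → D B i → D C l → B ≋ C → i ≡ l) →
    HasCardinality (Group.setoid H) k → HasCardinality (satisfying M) (j * k)
  orbits-cardinality {n} {j} 𝓐 A {M} {D} orbit index index-unique card =
    cardinality-via (satisfying M) (×-setoid (setoid (Fin j)) (Group.setoid H)) f g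
      (λ {(B , MB)} {(C , MC)} → f-cong {B} {C} (proj₂ (index B MB)) (proj₂ (index C MC)) (f-transports B MB) (f-transports C MC))
      (λ { {i , x} {.i , y} (refl , x≈y) →
           transports-cong (𝓐 i) (A i) {moved (𝓐 i) (A i) x} {moved (𝓐 i) (A i) y} {x} {y} (λ _ → refl) (λ _ → refl) x≈y })
      (λ (i , h) → let B , MB = g (i , h) in
        f-cong {B} {B} (proj₂ (index B MB)) (g-index i h) (f-transports B MB) (λ _ → refl) (λ _ → refl))
      (λ (B , MB) x → sym (f-transports B MB x))
      (×-cardinality _ _ (Fin-cardinality j) card)
    where
    transport : ∀ B MB → ∃ (Transports (𝓐 (proj₁ (index B MB))) (A (proj₁ (index B MB))) B)
    transport B MB = Equivalence.to (orbit (proj₁ (index B MB)) B) (MB , proj₂ (index B MB))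

    f : ∃ M → Fin j × H.Carrier
    f (B , MB) = proj₁ (index B MB) , proj₁ (transport B MB)

    f-transports : ∀ B MB → let i , h = f (B , MB) in Transports (𝓐 i) (A i) B h
    f-transports B MB = proj₂ (transport B MB)

    g : Fin j × H.Carrier → ∃ M
    g (i , h) = moved (𝓐 i) (A i) h , proj₁ (Equivalence.from (orbit i (moved (𝓐 i) (A i) h)) (h , λ _ → refl))

    g-index : ∀ i h → D (moved (𝓐 i) (A i) h) i
    g-index i h = proj₂ (Equivalence.from (orbit i (moved (𝓐 i) (A i) h)) (h , λ _ → refl))

    f-cong : ∀ {B C i l g h} → D B i → D C l →
      Transports (𝓐 i) (A i) B g → Transports (𝓐 l) (A l) C h → B ≋ C → i ≡ l × g H.≈ h
    f-cong {B} {C} {i} {l} {g} {h} DB DC tB tC B≋C = i≡l , same i≡l tC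
      where
      i≡l : i ≡ l
      i≡l = index-unique {B} {C} DB DC B≋C

      same : i ≡ l → Transports (𝓐 l) (A l) C h → g H.≈ h
      same refl tC = transports-injective (𝓐 i) (A i) {B} {C} tB tC B≋C

direction-resp : ∀ {B C : Labeling n} {j} → B ≋ C → HasDirection C j → HasDirection B j
direction-resp B≋C dir x y line = trans
  (cong₂ _+_ (cong (suc ∘ toℕ) (B≋C x)) (cong (suc ∘ toℕ) (B≋C y))) (dir x y line)

module _ {m} (even : Even m) where

  even-cardinality : HasCardinality (magicFacedHypercubes m) (2 ^ m * suc m !)
  even-cardinality = orbit-cardinality (evenAction m even) (evenLabeling even) (evenOrbit m even) (⋊-cardinality m)

  direction : ∀ (B : Labeling (suc m)) → MagicFaced B → ∃[ j ] HasDirection B j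
  direction B magic = let nf = magic⇒normalForm B magic
                          j , z = odd⇒coeff≡0 even nf
                      in j , coeff≡0⇒direction nf z

  odd-cardinality : HasCardinality (magicFacedHypercubes (suc m)) (suc m * (2 ^ suc m * suc m !))
  odd-cardinality = subst (HasCardinality (magicFacedHypercubes (suc m))) (cong (suc m *_) count)
    (orbits-cardinality (oddAction m even) (oddLabeling even) {D = HasDirection} (oddOrbit m even) direction
      (λ {B} {C} dB dC B≋C → direction-unique B dB (direction-resp {B = B} {C} B≋C dC))
      (×-cardinality (Group.setoid (C₂^ m ⋊S₁₊)) (Group.setoid C₂) (⋊-cardinality m) C₂-cardinality))
    where
    count : 2 ^ m * suc m ! * 2 ≡ 2 ^ suc m * suc m !
    count = solve 2 (λ a b → a :* b :* con 2 := con 2 :* a :* b) refl (2 ^ m) (suc m !)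
      where open +-*-Solver

theorem1 : (∀ (n : ℕ) → Σ[ A ∈ Labeling n ] MagicFaced A)
    × (∀ (n : ℕ) → 2 ∣ n →
    Σ[ G ∈ Subgroup (Sym (Position n)) ]
    (Subgroup.group G ≅ C₂^ n ⋊S₁₊)
    × IsSingleOrbit G MagicFaced)
    × (∀ (n : ℕ) → 2 ∤ n →
    (∀ (A : Labeling n) → MagicFaced A →
    ∃! _≡_ (λ (j : Fin n) → HasDirection A j))
    × (∀ (j : Fin n) →
    Σ[ G ∈ Subgroup (Sym (Position n)) ]
    (Subgroup.group G ≅ ((C₂^ pred n ⋊S₁₊) ×ᴳ C₂))
    × IsSingleOrbit G (λ A → MagicFaced A × HasDirection A j)))
    × (∀ (n : ℕ) → 2 ∣ n →
    HasCardinality (magicFacedHypercubes n) (2 ^ n * (suc n) !))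
    × (∀ (n : ℕ) → 2 ∤ n →
    HasCardinality (magicFacedHypercubes n) (n * (2 ^ n * n !)))
theorem1 =
    (λ n → existence n (parity n))
  , (λ n 2∣n → let 𝓐 = evenAction n (2∣⇒even 2∣n) in
      FaithfulAction.image 𝓐 , FaithfulAction.image≅ 𝓐 , singleOrbit 𝓐 (evenLabeling (2∣⇒even 2∣n)) (evenOrbit n (2∣⇒even 2∣n)))
  , (λ n 2∤n → oddPart (2∤⇒suc-even 2∤n))
  , (λ n 2∣n → even-cardinality (2∣⇒even 2∣n))
  , (λ n 2∤n → oddCount (2∤⇒suc-even 2∤n))
  where
  existence : ∀ n → 2 ∣ n ⊎ ∃[ m ] (n ≡ suc m × 2 ∣ m) → Σ[ A ∈ Labeling n ] MagicFaced A
  existence n (inj₁ 2∣n) = evenLabeling even ,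
    signed⇒magic (evenLabeling even) weights (λ _ → false) (λ k → k) (evenLabeling-value even)
    where even = 2∣⇒even 2∣n
  -- Any direction would do; `punchIn (suc zero)` skips the sign belonging to the chosen one.
  existence _ (inj₂ (m , refl , 2∣m)) = oddLabeling even zero ,
    signed⇒magic (oddLabeling even zero) powers (λ _ → false) (punchIn (suc zero)) (oddLabeling-value even zero)
    where even = 2∣⇒even 2∣m

  oddPart : ∀ {n} → ∃[ m ] (n ≡ suc m × 2 ∣ m) →
    (∀ (A : Labeling n) → MagicFaced A → ∃! _≡_ (λ j → HasDirection A j)) ×
    (∀ (j : Fin n) → Σ[ G ∈ Subgroup (Sym (Position n)) ]
      (Subgroup.group G ≅ ((C₂^ pred n ⋊S₁₊) ×ᴳ C₂)) ×
      IsSingleOrbit G (λ A → MagicFaced A × HasDirection A j))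
  oddPart (m , refl , 2∣m) =
    (λ A magic → let j , dir = direction even A magic in j , dir , direction-unique A dir) ,
    (λ j → FaithfulAction.image (oddAction m even j) , FaithfulAction.image≅ (oddAction m even j) ,
           singleOrbit (oddAction m even j) (oddLabeling even j) (oddOrbit m even j))
    where even = 2∣⇒even 2∣m

  oddCount : ∀ {n} → ∃[ m ] (n ≡ suc m × 2 ∣ m) → HasCardinality (magicFacedHypercubes n) (n * (2 ^ n * n !))
  oddCount (m , refl , 2∣m) = odd-cardinality (2∣⇒even 2∣m)
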